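{- Let $G$ be a crown-free linear $3$-graph on $n$ vertices, and let $s$ be the number of vertices of $G$ of degree at least $6$. If $s \leq 2$, then the number of edges of $G$ satisfies $$|E(G)| \leq \frac{10(n-s)}{7}.$$
   Context: A linear $3$-graph $G=(V,E)$ consists of a finite vertex set $V$ and a collection $E$ of $3$-element subsets of $V$ (edges) such that any two distinct edges share at most one vertex. The degree $d(v)$ of a vertex $v$ is the number of edges containing $v$. The crown $C_{13}$ is the linear $3$-graph on $9$ vertices $\{a,b,c,d,e,f,g,h,i\}$ with edges $\{a,b,c\},\{a,d,e\},\{b,f,g\},\{c,h,i\}$. A linear $3$-graph is crown-free if it contains no copy of $C_{13}$, i.e. no four of its edges together with an injective assignment of the nine vertices form the crown. -}

module Defs where

open import Data.Fin.Base using (Fin)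
open import Data.Fin.Subset using (Subset; ⁅_⁆; _∪_; _∩_; ∣_∣)
open import Data.Fin.Subset.Properties using (_∈?_)
open import Data.List.Base using (List; []; _∷_; length; filter; allFin)
open import Data.List.Membership.Propositional using (_∈_)
open import Data.List.Relation.Unary.Unique.Propositional using (Unique)
open import Data.Nat.Base using (ℕ; _≤_)
open import Data.Nat.Properties using (_≤?_)
open import Relation.Binary.PropositionalEquality using (_≡_; _≢_)
open import Relation.Nullary using (¬_)

-- The vertex set is Fin n.  The finite set of edges is a duplicate-free list,
-- so that its length is its cardinality.
record Linear3Graph (n : ℕ) : Set where
  field
    edges        : List (Subset n)
    edges-unique : Unique edges
    edges-size   : ∀ {e} → e ∈ edges → ∣ e ∣ ≡ 3
    edges-linear : ∀ {e f} → e ∈ edges → f ∈ edges → e ≢ f → ∣ e ∩ f ∣ ≤ 1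

open Linear3Graph public

edgeCount : ∀ {n} → Linear3Graph n → ℕ
edgeCount G = length (edges G)

degree : ∀ {n} → Linear3Graph n → Fin n → ℕ
degree G v = length (filter (v ∈?_) (edges G))

countDegreeAtLeast : ∀ {n} → ℕ → Linear3Graph n → ℕ
countDegreeAtLeast {n} k G = length (filter (λ v → k ≤? degree G v) (allFin n))

⁅_,_,_⁆ : ∀ {n} → Fin n → Fin n → Fin n → Subset n
⁅ x , y , z ⁆ = ⁅ x ⁆ ∪ ⁅ y ⁆ ∪ ⁅ z ⁆

-- A (not necessarily induced) copy of the crown C₁₃ in G.
record Crown {n : ℕ} (G : Linear3Graph n) : Set where
  field
    a b c d e f g h i : Fin n
    distinct : Unique (a ∷ b ∷ c ∷ d ∷ e ∷ f ∷ g ∷ h ∷ i ∷ [])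
    abc∈E    : ⁅ a , b , c ⁆ ∈ edges G
    ade∈E    : ⁅ a , d , e ⁆ ∈ edges G
    bfg∈E    : ⁅ b , f , g ⁆ ∈ edges G
    chi∈E    : ⁅ c , h , i ⁆ ∈ edges G

CrownFree : ∀ {n} → Linear3Graph n → Set
CrownFree G = ¬ Crown G

-- Discharging.  A vertex of degree at most 5 hands out at most 20 units to its edges, a vertex of degree at
-- least 6 hands out nothing, and every edge receives at least 14; hence 14 |E| ≤ 20 (n - s).  Splitting the
-- 20 units evenly fails on three kinds of edges only, because an edge with degrees (≥6, ≥4, ≥2) is greedily
-- seen to be the base of a crown.
--  * Degrees (≥6, 3, 3): a vertex of degree 3 lies on at most s ≤ 2 edges with a vertex of degree at least 6,
--    so it can give these 7 and the others 6.
--  * Degrees (5, 5, 4) and (5, 5, 5): let abc be such an edge with d(a) = d(b) = 5.  The links of a and b are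
--    perfect matchings of two disjoint 4-sets, which together with the link of c form two copies of K₄ (up to
--    a missing edge).  A vertex of the link of degree at least 4 would give a crown, so on every other edge at
--    a both remaining vertices have degree at most 3, and a can give 8 to abc and 3 to each other edge.
module Submission where

open import Defs
open import Data.Nat.Base using (ℕ; _≤_)
open import Data.Integer.Base using (+_; _*_; _-_)
open import Data.Rational.Base using (_/_) renaming (_≤_ to _≤ℚ_)

open import Data.Bool.Base using (Bool; true; false; not)
import Data.Bool.Properties as Bool
open import Data.Empty using (⊥; ⊥-elim)
open import Data.Fin using (Fin; zero; suc; toℕ; #_)
import Data.Fin.Properties as Fin
open import Data.Fin.Subset using (Subset; inside; outside; _∈_; _∉_; ∣_∣; _∩_) renaming (⁅_⁆ to singleton)
open import Data.Fin.Subset.Properties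
open import Data.Integer.Base using (+≤+) renaming (_≤_ to _≤ℤ_)
import Data.Integer.Properties as ℤ
open import Data.List.Base using (List; []; _∷_; length; filter; allFin; map; tabulate)
import Data.List.Properties as List
open import Data.List.Membership.Propositional using (find; lose) renaming (_∈_ to _∈ᴸ_)
open import Data.List.Membership.Propositional.Properties using (∈-filter⁺; ∈-filter⁻; ∈-allFin)
open import Data.List.Relation.Unary.All as All using (All; []; _∷_)
open import Data.List.Relation.Unary.AllPairs using ([]; _∷_)
open import Data.List.Relation.Unary.Any as Any using (here; there)
open import Data.List.Relation.Unary.Unique.Propositional using (Unique)
import Data.List.Relation.Unary.Unique.Propositional.Properties as Unique
open import Data.Nat.Base using (zero; suc; z≤n; s≤s; _<_; _+_; _∸_) renaming (_*_ to _*ℕ_)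
open import Data.Nat.ListAction using (sum)
import Data.Nat.Properties as ℕ
open import Data.Nat.Solver using (module +-*-Solver)
open import Data.Product.Base using (∃-syntax; _×_; _,_; proj₁; proj₂)
import Data.Rational.Properties as ℚ
open import Data.Rational.Unnormalised.Base using (mkℚᵘ; *≤*)
import Data.Rational.Unnormalised.Properties as ℚᵘ
open import Data.Sum.Base as Sum using (_⊎_; inj₁; inj₂)
open import Data.Vec.Base using ([]; _∷_; lookup)
open import Data.Vec.Properties using (≡-dec)
open import Function.Base using (_∘_; id; case_of_)
open import Relation.Binary.PropositionalEquality
  using (_≡_; _≢_; refl; sym; trans; cong; cong₂; subst; subst₂; ≢-sym; module ≡-Reasoning)
open import Relation.Nullary using (¬_; Dec; yes; no; does; ¬?)
open import Relation.Nullary.Decidable using (toWitness; _×-dec_; _⊎-dec_; _→-dec_)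
open import Relation.Nullary.Negation using (contradiction)
open import Relation.Unary using (Decidable)

open +-*-Solver using (solve; _:=_; _:+_; _:*_; con)

private
  variable
    n : ℕ

-- Finite subsets as duplicate-free lists

elements : Subset n → List (Fin n)
elements p = filter (_∈? p) (allFin _)

does-∈? : ∀ (i : Fin n) p → does (i ∈? p) ≡ lookup p i
does-∈? zero    (inside  ∷ p) = refl
does-∈? zero    (outside ∷ p) = refl
does-∈? (suc i) (s       ∷ p) = does-∈? i p

-- Stated for an arbitrary `f` because the induction on `p` replaces `f` by `f ∘ suc`.
length-filter-tabulate : ∀ {A : Set} {P : A → Set} (P? : Decidable P) (f : Fin n → A) p →
  (∀ i → does (P? (f i)) ≡ lookup p i) → length (filter P? (tabulate f)) ≡ ∣ p ∣
length-filter-tabulate P? f []            eq = refl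
length-filter-tabulate P? f (inside  ∷ p) eq rewrite eq zero =
  cong suc (length-filter-tabulate P? (f ∘ suc) p (eq ∘ suc))
length-filter-tabulate P? f (outside ∷ p) eq rewrite eq zero =
  length-filter-tabulate P? (f ∘ suc) p (eq ∘ suc)

length-elements : (p : Subset n) → length (elements p) ≡ ∣ p ∣
length-elements p = length-filter-tabulate (_∈? p) id p (λ i → does-∈? i p)

∈-elements⁺ : ∀ {x} {p : Subset n} → x ∈ p → x ∈ᴸ elements p
∈-elements⁺ {p = p} x∈p = ∈-filter⁺ (_∈? p) (∈-allFin _) x∈p

∈-elements⁻ : ∀ {x} {p : Subset n} → x ∈ᴸ elements p → x ∈ p
∈-elements⁻ {p = p} = proj₂ ∘ ∈-filter⁻ (_∈? p) {xs = allFin _}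

elements-unique : (p : Subset n) → Unique (elements p)
elements-unique p = Unique.filter⁺ (_∈? p) (Unique.allFin⁺ _)

distinct⇒length≤ : ∀ {xs} {p : Subset n} → Unique xs → All (_∈ p) xs → length xs ≤ ∣ p ∣
distinct⇒length≤ []         []           = z≤n
distinct⇒length≤ (x≢ ∷ xs!) (x∈p ∷ xs∈p) =
  ℕ.≤-trans
    (s≤s (distinct⇒length≤ xs!
      (All.zipWith (λ (x≢y , y∈p) → x∈p∧x≢y⇒x∈p-y y∈p (≢-sym x≢y)) (x≢ , xs∈p))))
    (x∈p⇒∣p-x∣<∣p∣ x∈p)

-- Meant for the edges at `v` and the property of containing a fixed vertex other than `v`: by
-- linearity at most one edge has it, so discarding such edges costs at most one.
filter-atMostOne : ∀ {A : Set} {P : A → Set} (P? : Decidable P) {xs} → Unique xs →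
  (∀ {x y} → x ∈ᴸ xs → y ∈ᴸ xs → P x → P y → x ≡ y) →
  length xs ≤ suc (length (filter (¬? ∘ P?) xs))
filter-atMostOne P? []                    one = z≤n
filter-atMostOne P? {x ∷ xs} (x≢xs ∷ xs!) one with P? x
... | no _   = s≤s (filter-atMostOne P? xs! (λ y∈ z∈ → one (there y∈) (there z∈)))
... | yes Px = s≤s (ℕ.≤-reflexive (sym (cong length (List.filter-all (¬? ∘ P?)
      (All.tabulate (λ y∈ Py → All.lookup x≢xs y∈ (one (here refl) (there y∈) Px Py)))))))

⁅⁆⁻ : ∀ {x y z u : Fin n} → u ∈ ⁅ x , y , z ⁆ → u ≡ x ⊎ u ≡ y ⊎ u ≡ z
⁅⁆⁻ {x = x} {y} {z} u∈ with x∈p∪q⁻ (singleton x) _ u∈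
... | inj₁ u∈x = inj₁ (x∈⁅y⁆⇒x≡y x u∈x)
... | inj₂ u∈yz with x∈p∪q⁻ (singleton y) _ u∈yz
... | inj₁ u∈y = inj₂ (inj₁ (x∈⁅y⁆⇒x≡y y u∈y))
... | inj₂ u∈z = inj₂ (inj₂ (x∈⁅y⁆⇒x≡y z u∈z))

⁅⁆⁺ : ∀ {x y z u : Fin n} → u ≡ x ⊎ u ≡ y ⊎ u ≡ z → u ∈ ⁅ x , y , z ⁆
⁅⁆⁺ (inj₁ refl)        = x∈p∪q⁺ (inj₁ (x∈⁅x⁆ _))
⁅⁆⁺ (inj₂ (inj₁ refl)) = x∈p∪q⁺ (inj₂ (x∈p∪q⁺ (inj₁ (x∈⁅x⁆ _))))
⁅⁆⁺ (inj₂ (inj₂ refl)) = x∈p∪q⁺ (inj₂ (x∈p∪q⁺ (inj₂ (x∈⁅x⁆ _))))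

-- Edges, avoidance and crowns

twoOfThree : ∀ (i j k : Bool) → i ≡ j ⊎ i ≡ k ⊎ j ≡ k
twoOfThree i j k with i Bool.≟ j | i Bool.≟ k
... | yes i≡j | _       = inj₁ i≡j
... | no _    | yes i≡k = inj₂ (inj₁ i≡k)
... | no i≢j  | no i≢k  = inj₂ (inj₂ (Bool.not-injective (trans (sym (Bool.¬-not i≢j)) (Bool.¬-not i≢k))))

module Edges {n : ℕ} (G : Linear3Graph n) where

  Edge : Set
  Edge = ∃[ e ] e ∈ᴸ edges G

  infix 4 _∈ᵉ_ _∉ᵉ_ _∥_

  _∈ᵉ_ _∉ᵉ_ : Fin n → Edge → Set
  v ∈ᵉ e = v ∈ proj₁ e
  v ∉ᵉ e = ¬ v ∈ᵉ e

  Meet _∥_ : Edge → Edge → Set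
  Meet e f = ∃[ v ] v ∈ᵉ e × v ∈ᵉ f
  e ∥ f    = ∀ {v} → v ∈ᵉ e → v ∈ᵉ f → ⊥

  meet? : ∀ e f → Meet e f ⊎ e ∥ f
  meet? e f with nonempty? (proj₁ e ∩ proj₁ f)
  ... | yes (v , v∈) = inj₁ (v , x∈p∩q⁻ _ _ v∈)
  ... | no ∄v        = inj₂ (λ v∈e v∈f → ∄v (_ , x∈p∩q⁺ (v∈e , v∈f)))

  ∥-sym : ∀ {e f} → e ∥ f → f ∥ e
  ∥-sym e∥f v∈f v∈e = e∥f v∈e v∈f

  Meet-sym : ∀ {e f} → Meet e f → Meet f e
  Meet-sym (v , v∈e , v∈f) = v , v∈f , v∈e

  coincide-≡ : ∀ {e f} → e ∈ᴸ edges G → f ∈ᴸ edges G → ∀ {x y} → x ≢ y →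
    x ∈ e → y ∈ e → x ∈ f → y ∈ f → e ≡ f
  coincide-≡ {e} {f} e∈ f∈ x≢y x∈e y∈e x∈f y∈f with ≡-dec Bool._≟_ e f
  ... | yes e≡f = e≡f
  ... | no e≢f  = contradiction
    (ℕ.≤-trans (distinct⇒length≤ ((x≢y ∷ []) ∷ [] ∷ [])
                 (x∈p∩q⁺ (x∈e , x∈f) ∷ x∈p∩q⁺ (y∈e , y∈f) ∷ []))
               (edges-linear G e∈ f∈ e≢f))
    λ { (s≤s ()) }

  coincide : ∀ e f {x y z} → x ≢ y →
    x ∈ᵉ e → y ∈ᵉ e → x ∈ᵉ f → y ∈ᵉ f → z ∈ᵉ e → z ∈ᵉ f
  coincide e f x≢y x∈e y∈e x∈f y∈f =
    subst (λ p → _ ∈ p) (coincide-≡ (proj₂ e) (proj₂ f) x≢y x∈e y∈e x∈f y∈f)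

  -- Otherwise `x`, `u`, `v`, `w` would be four distinct vertices of one edge.
  pigeonhole : ∀ e {x u v w} → x ∈ᵉ e → u ∈ᵉ e → v ∈ᵉ e → w ∈ᵉ e →
    u ≢ x → v ≢ x → w ≢ x → u ≡ v ⊎ u ≡ w ⊎ v ≡ w
  pigeonhole e {x} {u} {v} {w} x∈ u∈ v∈ w∈ u≢x v≢x w≢x
    with u Fin.≟ v | u Fin.≟ w | v Fin.≟ w
  ... | yes u≡v | _       | _       = inj₁ u≡v
  ... | no _    | yes u≡w | _       = inj₂ (inj₁ u≡w)
  ... | no _    | no _    | yes v≡w = inj₂ (inj₂ v≡w)
  ... | no u≢v  | no u≢w  | no v≢w  = contradiction
    (subst (4 ≤_) (edges-size G {proj₁ e} (proj₂ e))
      (distinct⇒length≤ ((≢-sym u≢x ∷ ≢-sym v≢x ∷ ≢-sym w≢x ∷ []) ∷ (u≢v ∷ u≢w ∷ [])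
                          ∷ (v≢w ∷ []) ∷ [] ∷ [])
                        (x∈ ∷ u∈ ∷ v∈ ∷ w∈ ∷ [])))
    λ { (s≤s (s≤s (s≤s ()))) }

  cover : ∀ e {x y z} → x ≢ y → x ≢ z → y ≢ z → x ∈ᵉ e → y ∈ᵉ e → z ∈ᵉ e →
    ∀ {u} → u ∈ᵉ e → u ≡ x ⊎ u ≡ y ⊎ u ≡ z
  cover e {x} x≢y x≢z y≢z x∈ y∈ z∈ {u} u∈ with u Fin.≟ x
  ... | yes u≡x = inj₁ u≡x
  ... | no u≢x with pigeonhole e x∈ u∈ y∈ z∈ u≢x (≢-sym x≢y) (≢-sym x≢z)
  ...   | inj₁ u≡y        = inj₂ (inj₁ u≡y)
  ...   | inj₂ (inj₁ u≡z) = inj₂ (inj₂ u≡z)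
  ...   | inj₂ (inj₂ y≡z) = contradiction y≡z y≢z

  elements-triple : ∀ e → ∃[ x ] ∃[ y ] ∃[ z ] elements (proj₁ e) ≡ x ∷ y ∷ z ∷ []
  elements-triple (e , e∈)
    with elements e | trans (length-elements e) (edges-size G {e} e∈)
  ... | x ∷ y ∷ z ∷ [] | refl = x , y , z , refl

  -- The edge as seen from `v`. The field `total` brings a sum over `elements` into a form with `v`
  -- first, wherever `v` stands in that list.
  record Others (e : Edge) (v : Fin n) : Set where
    field
      p q   : Fin n
      v≢p   : v ≢ p
      v≢q   : v ≢ q
      p≢q   : p ≢ q
      p∈    : p ∈ᵉ e
      q∈    : q ∈ᵉ e
      split : ∀ {u} → u ∈ᵉ e → u ≡ v ⊎ u ≡ p ⊎ u ≡ q
      total : ∀ (f : Fin n → ℕ) → sum (map f (elements (proj₁ e))) ≡ f v + (f p + f q)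

  others : ∀ e {v} → v ∈ᵉ e → Others e v
  others e v∈ with elements-triple e
  ... | x , y , z , eq with subst Unique eq (elements-unique (proj₁ e))
                           | subst (λ L → _ ∈ᴸ L) eq (∈-elements⁺ v∈)
  ... | (x≢y ∷ x≢z ∷ []) ∷ (y≢z ∷ []) ∷ [] ∷ [] | v∈xyz = go v∈xyz
    where
    mem : ∀ {u} → u ∈ᴸ (x ∷ y ∷ z ∷ []) → u ∈ᵉ e
    mem u∈ = ∈-elements⁻ (subst (λ L → _ ∈ᴸ L) (sym eq) u∈)
    mk : ∀ {v p q} → v ≢ p → v ≢ q → p ≢ q → v ∈ᵉ e → p ∈ᵉ e → q ∈ᵉ e →
      (∀ (f : Fin n → ℕ) → f x + (f y + (f z + 0)) ≡ f v + (f p + f q)) → Others e v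
    mk v≢p v≢q p≢q v∈ p∈ q∈ perm = record
      { v≢p = v≢p ; v≢q = v≢q ; p≢q = p≢q ; p∈ = p∈ ; q∈ = q∈
      ; split = cover e v≢p v≢q p≢q v∈ p∈ q∈
      ; total = λ f → trans (cong (sum ∘ map f) eq) (perm f) }
    x∈ = mem (here refl)
    y∈ = mem (there (here refl))
    z∈ = mem (there (there (here refl)))
    go : ∀ {v} → v ∈ᴸ (x ∷ y ∷ z ∷ []) → Others e v
    go (here refl) = mk x≢y x≢z y≢z x∈ y∈ z∈
      λ f → solve 3 (λ a b c → a :+ (b :+ (c :+ con 0)) := a :+ (b :+ c)) refl (f x) (f y) (f z)
    go (there (here refl)) = mk (≢-sym x≢y) y≢z x≢z y∈ x∈ z∈
      λ f → solve 3 (λ a b c → a :+ (b :+ (c :+ con 0)) := b :+ (a :+ c)) refl (f x) (f y) (f z)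
    go (there (there (here refl))) = mk (≢-sym x≢z) (≢-sym y≢z) x≢y z∈ x∈ y∈
      λ f → solve 3 (λ a b c → a :+ (b :+ (c :+ con 0)) := c :+ (a :+ b)) refl (f x) (f y) (f z)

  edgesAt : Fin n → List (Subset n)
  edgesAt v = filter (v ∈?_) (edges G)

  -- Greedy choice: edges through both `v` and `x` coincide, so each forbidden vertex rules out at
  -- most one edge. The list `L` is a parameter because the recursion continues with the edges that
  -- avoid `x`.
  avoidFrom : ∀ {v} xs (L : List (Subset n)) → Unique L →
    (∀ {e} → e ∈ᴸ L → e ∈ᴸ edges G × v ∈ e) →
    All (v ≢_) xs → length xs < length L → ∃[ e ] e ∈ᴸ L × All (_∉ e) xs
  avoidFrom []       (e ∷ L) L! ⊆E [] _ = e , here refl , []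
  avoidFrom {v} (x ∷ xs) L   L! ⊆E (v≢x ∷ v≢xs) xs<L
    with avoidFrom xs (filter (¬? ∘ (x ∈?_)) L) (Unique.filter⁺ (¬? ∘ (x ∈?_)) L!)
           (⊆E ∘ proj₁ ∘ ∈-filter⁻ (¬? ∘ (x ∈?_))) v≢xs
           (ℕ.≤-pred (ℕ.≤-trans xs<L (filter-atMostOne (x ∈?_) L! same)))
    where
    same : ∀ {e f} → e ∈ᴸ L → f ∈ᴸ L → x ∈ e → x ∈ f → e ≡ f
    same e∈ f∈ x∈e x∈f =
      coincide-≡ (proj₁ (⊆E e∈)) (proj₁ (⊆E f∈)) v≢x (proj₂ (⊆E e∈)) x∈e (proj₂ (⊆E f∈)) x∈f
  ... | e , e∈ , xs∉ = let e∈L , x∉ = ∈-filter⁻ (¬? ∘ (x ∈?_)) e∈ in e , e∈L , x∉ ∷ xs∉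

  avoid : ∀ v xs → All (v ≢_) xs → length xs < degree G v →
    ∃[ e ] v ∈ᵉ e × All (_∉ᵉ e) xs
  avoid v xs v≢xs xs<d
    with avoidFrom xs (edgesAt v) (Unique.filter⁺ (v ∈?_) (edges-unique G))
           (∈-filter⁻ (v ∈?_)) v≢xs xs<d
  ... | e , e∈ , xs∉ = let e∈E , v∈ = ∈-filter⁻ (v ∈?_) e∈ in (e , e∈E) , v∈ , xs∉

  triple∈edges : ∀ e {x y z} → x ≢ y → x ≢ z → y ≢ z → x ∈ᵉ e → y ∈ᵉ e → z ∈ᵉ e →
    ⁅ x , y , z ⁆ ∈ᴸ edges G
  triple∈edges e x≢y x≢z y≢z x∈ y∈ z∈ = subst (_∈ᴸ edges G)
    (⊆-antisym (⁅⁆⁺ ∘ cover e x≢y x≢z y≢z x∈ y∈ z∈)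
               (λ u∈ → case ⁅⁆⁻ u∈ of λ
                 { (inj₁ refl) → x∈ ; (inj₂ (inj₁ refl)) → y∈ ; (inj₂ (inj₂ refl)) → z∈ }))
    (proj₂ e)

  -- Disjointness makes the three meeting points distinct, so they exhaust `e₀`. No vertex lies on
  -- two of `e₁`, `e₂`, `e₃`, hence all nine vertices differ.
  crown : ∀ e₀ e₁ e₂ e₃ → Meet e₀ e₁ → Meet e₀ e₂ → Meet e₀ e₃ →
    e₁ ∥ e₂ → e₁ ∥ e₃ → e₂ ∥ e₃ → Crown G
  crown e₀ e₁ e₂ e₃ (a , a∈₀ , a∈₁) (b , b∈₀ , b∈₂) (c , c∈₀ , c∈₃) ₁∥₂ ₁∥₃ ₂∥₃ = record
    { a = a ; b = b ; c = c ; d = A.p ; e = A.q ; f = B.p ; g = B.q ; h = C.p ; i = C.q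
    ; distinct =
          (₁≢₂ a∈₁ b∈₂ ∷ ₁≢₃ a∈₁ c∈₃ ∷ A.v≢p ∷ A.v≢q ∷ ₁≢₂ a∈₁ B.p∈ ∷ ₁≢₂ a∈₁ B.q∈
            ∷ ₁≢₃ a∈₁ C.p∈ ∷ ₁≢₃ a∈₁ C.q∈ ∷ [])
        ∷ (₂≢₃ b∈₂ c∈₃ ∷ ≢-sym (₁≢₂ A.p∈ b∈₂) ∷ ≢-sym (₁≢₂ A.q∈ b∈₂) ∷ B.v≢p ∷ B.v≢q
            ∷ ₂≢₃ b∈₂ C.p∈ ∷ ₂≢₃ b∈₂ C.q∈ ∷ [])
        ∷ (≢-sym (₁≢₃ A.p∈ c∈₃) ∷ ≢-sym (₁≢₃ A.q∈ c∈₃) ∷ ≢-sym (₂≢₃ B.p∈ c∈₃)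
            ∷ ≢-sym (₂≢₃ B.q∈ c∈₃) ∷ C.v≢p ∷ C.v≢q ∷ [])
        ∷ (A.p≢q ∷ ₁≢₂ A.p∈ B.p∈ ∷ ₁≢₂ A.p∈ B.q∈ ∷ ₁≢₃ A.p∈ C.p∈ ∷ ₁≢₃ A.p∈ C.q∈ ∷ [])
        ∷ (₁≢₂ A.q∈ B.p∈ ∷ ₁≢₂ A.q∈ B.q∈ ∷ ₁≢₃ A.q∈ C.p∈ ∷ ₁≢₃ A.q∈ C.q∈ ∷ [])
        ∷ (B.p≢q ∷ ₂≢₃ B.p∈ C.p∈ ∷ ₂≢₃ B.p∈ C.q∈ ∷ [])
        ∷ (₂≢₃ B.q∈ C.p∈ ∷ ₂≢₃ B.q∈ C.q∈ ∷ [])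
        ∷ (C.p≢q ∷ [])
        ∷ [] ∷ []
    ; abc∈E = triple∈edges e₀ (₁≢₂ a∈₁ b∈₂) (₁≢₃ a∈₁ c∈₃) (₂≢₃ b∈₂ c∈₃) a∈₀ b∈₀ c∈₀
    ; ade∈E = triple∈edges e₁ A.v≢p A.v≢q A.p≢q a∈₁ A.p∈ A.q∈
    ; bfg∈E = triple∈edges e₂ B.v≢p B.v≢q B.p≢q b∈₂ B.p∈ B.q∈
    ; chi∈E = triple∈edges e₃ C.v≢p C.v≢q C.p≢q c∈₃ C.p∈ C.q∈
    }
    where
    module A = Others (others e₁ a∈₁)
    module B = Others (others e₂ b∈₂)
    module C = Others (others e₃ c∈₃)
    ₁≢₂ : ∀ {x y} → x ∈ᵉ e₁ → y ∈ᵉ e₂ → x ≢ y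
    ₁≢₂ x∈ y∈ refl = ₁∥₂ x∈ y∈
    ₁≢₃ : ∀ {x y} → x ∈ᵉ e₁ → y ∈ᵉ e₃ → x ≢ y
    ₁≢₃ x∈ y∈ refl = ₁∥₃ x∈ y∈
    ₂≢₃ : ∀ {x y} → x ∈ᵉ e₂ → y ∈ᵉ e₃ → x ≢ y
    ₂≢₃ x∈ y∈ refl = ₂∥₃ x∈ y∈

  disjointBy : ∀ {e} f {v} (o : Others e v) → let open Others o in
    v ∉ᵉ f → p ∉ᵉ f → q ∉ᵉ f → e ∥ f
  disjointBy f o v∉ p∉ q∉ u∈e u∈f with Others.split o u∈e
  ... | inj₁ refl        = v∉ u∈f
  ... | inj₂ (inj₁ refl) = p∉ u∈f
  ... | inj₂ (inj₂ refl) = q∉ u∈f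

  -- Edges at `z`, `y`, `x` are chosen greedily in this order. Each avoids one further vertex of
  -- `e`, so as to differ from `e`, and the two outer vertices of every edge chosen before: 1, 3 and
  -- 5 vertices, one fewer than the degree bounds.
  crown-642 : ∀ e {x y z} → x ≢ y → x ≢ z → y ≢ z → x ∈ᵉ e → y ∈ᵉ e → z ∈ᵉ e →
    6 ≤ degree G x → 4 ≤ degree G y → 2 ≤ degree G z → Crown G
  crown-642 e {x} {y} {z} x≢y x≢z y≢z x∈e y∈e z∈e 6≤dx 4≤dy 2≤dz
    with avoid z (x ∷ []) (≢-sym x≢z ∷ []) 2≤dz
  ... | Z , z∈Z , x∉Z ∷ []
    with (λ (y∈Z : y ∈ᵉ Z) → x∉Z (coincide e Z y≢z y∈e z∈e y∈Z z∈Z x∈e)) | others Z z∈Z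
  ... | y∉Z | oZ@record { p = p ; q = q ; p∈ = p∈Z ; q∈ = q∈Z }
    with avoid y (x ∷ p ∷ q ∷ []) (≢-sym x≢y ∷ (λ { refl → y∉Z p∈Z }) ∷ (λ { refl → y∉Z q∈Z }) ∷ []) 4≤dy
  ... | Y , y∈Y , x∉Y ∷ p∉Y ∷ q∉Y ∷ []
    with others Y y∈Y
  ... | oY@record { p = r ; q = s ; p∈ = r∈Y ; q∈ = s∈Y }
    with avoid x (y ∷ p ∷ q ∷ r ∷ s ∷ [])
      (x≢y ∷ (λ { refl → x∉Z p∈Z }) ∷ (λ { refl → x∉Z q∈Z })
           ∷ (λ { refl → x∉Y r∈Y }) ∷ (λ { refl → x∉Y s∈Y }) ∷ [])
      6≤dx
  ... | X , x∈X , y∉X ∷ p∉X ∷ q∉X ∷ r∉X ∷ s∉X ∷ [] =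
    crown e Z Y X (z , z∈e , z∈Z) (y , y∈e , y∈Y) (x , x∈e , x∈X)
      (disjointBy Y oZ z∉Y p∉Y q∉Y) (disjointBy X oZ z∉X p∉X q∉X) (disjointBy X oY y∉X r∉X s∉X)
    where
    z∉Y : z ∉ᵉ Y
    z∉Y z∈Y = x∉Y (coincide e Y y≢z y∈e z∈e y∈Y z∈Y x∈e)
    z∉X : z ∉ᵉ X
    z∉X z∈X = y∉X (coincide e X x≢z x∈e z∈e x∈X z∈X y∈e)

-- The link of an edge with degrees (5, 5, ≥4)

module Link {n : ℕ} (G : Linear3Graph n) (free : CrownFree G) (e₀ : Edges.Edge G) where

  open Edges G

  -- For `h` on `e₀` these are the edges at `h` other than `e₀`; by linearity that is the same as
  -- the condition `only`.
  record Spoke (h : Fin n) : Set where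
    field
      edge : Edge
      hub∈ : h ∈ᵉ edge
      only : ∀ {u} → u ∈ᵉ e₀ → u ∈ᵉ edge → u ≡ h

  open Spoke

  infix 4 _∈ˢ_ _∉ˢ_ _∥ˢ_

  _∈ˢ_ _∉ˢ_ : ∀ {h} → Fin n → Spoke h → Set
  u ∈ˢ X = u ∈ᵉ edge X
  u ∉ˢ X = ¬ u ∈ˢ X

  Meetˢ _∥ˢ_ : ∀ {h k} → Spoke h → Spoke k → Set
  Meetˢ X Y = Meet (edge X) (edge Y)
  X ∥ˢ Y    = edge X ∥ edge Y

  -- For spokes with a common hub this amounts, by linearity, to being different edges.
  Sep : ∀ {h} → Spoke h → Spoke h → Set
  Sep {h} X Y = ∀ {u} → u ∈ˢ X → u ∈ˢ Y → u ≡ h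

  sep-sym : ∀ {h} (X Y : Spoke h) → Sep X Y → Sep Y X
  sep-sym X Y sep u∈Y u∈X = sep u∈X u∈Y

  sepBy : ∀ {h p} (X Y : Spoke h) → p ≢ h → p ∈ˢ X → p ∉ˢ Y → Sep X Y
  sepBy {h} X Y p≢h p∈X p∉Y {u} u∈X u∈Y with u Fin.≟ h
  ... | yes u≡h = u≡h
  ... | no u≢h  = contradiction (coincide (edge X) (edge Y) u≢h u∈X (hub∈ X) u∈Y (hub∈ Y) p∈X) p∉Y

  hub∉ : ∀ {h k} → k ≢ h → k ∈ᵉ e₀ → (X : Spoke h) → k ∉ˢ X
  hub∉ k≢h k∈ X k∈X = k≢h (only X k∈ k∈X)

  -- The vertex `mark` serves later choices: a spoke at `h` that avoids it is a different edge.
  record Pick (h : Fin n) (xs : List (Fin n)) : Set where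
    field
      pick   : Spoke h
      avoids : All (_∉ˢ pick) xs
      mark   : Fin n
      h≢mark : h ≢ mark
      mark∈  : mark ∈ˢ pick

  abstract
    -- The additional 1 in the degree bound pays for avoiding a second vertex `k` of `e₀`, which
    -- rules out `e₀` itself.
    spoke : ∀ {h} → h ∈ᵉ e₀ → ∀ xs → All (h ≢_) xs → suc (length xs) < degree G h → Pick h xs
    spoke {h} h∈ xs h≢xs xs<d with others e₀ h∈
    ... | record { p = k ; v≢p = h≢k ; p∈ = k∈ } with avoid h (k ∷ xs) (h≢k ∷ h≢xs) xs<d
    ... | X , h∈X , k∉X ∷ xs∉X = record
      { pick   = record { edge = X ; hub∈ = h∈X ; only = only′ } ; avoids = xs∉X
      ; mark   = Others.p (others X h∈X) ; h≢mark = Others.v≢p (others X h∈X)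
      ; mark∈  = Others.p∈ (others X h∈X) }
      where
      only′ : ∀ {u} → u ∈ᵉ e₀ → u ∈ᵉ X → u ≡ h
      only′ {u} u∈ u∈X with u Fin.≟ h
      ... | yes u≡h = u≡h
      ... | no u≢h  = contradiction (coincide e₀ X u≢h u∈ h∈ u∈X h∈X k∈) k∉X

  -- Besides `h` there are only two vertices on `X`. Two of the three meeting points therefore
  -- agree, and separation makes the common point `k`, which is not on `X`.
  meetAtMostTwo : ∀ {h k} → k ≢ h → h ∈ᵉ e₀ → k ∈ᵉ e₀ → (X : Spoke h) (Y₁ Y₂ Y₃ : Spoke k) →
    Sep Y₁ Y₂ → Sep Y₁ Y₃ → Sep Y₂ Y₃ →
    Meetˢ X Y₁ → Meetˢ X Y₂ → Meetˢ X Y₃ → ⊥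
  meetAtMostTwo {h} k≢h h∈ k∈ X Y₁ Y₂ Y₃ s₁₂ s₁₃ s₂₃ (u₁ , u₁∈X , u₁∈Y) (u₂ , u₂∈X , u₂∈Y) (u₃ , u₃∈X , u₃∈Y)
    with pigeonhole (edge X) (hub∈ X) u₁∈X u₂∈X u₃∈X (≢h Y₁ u₁∈Y) (≢h Y₂ u₂∈Y) (≢h Y₃ u₃∈Y)
    where
    ≢h : ∀ Y {u} → u ∈ˢ Y → u ≢ h
    ≢h Y u∈Y refl = hub∉ (≢-sym k≢h) h∈ Y u∈Y
  ... | inj₁ refl        = hub∉ k≢h k∈ X (subst (_∈ˢ X) (s₁₂ u₁∈Y u₂∈Y) u₁∈X)
  ... | inj₂ (inj₁ refl) = hub∉ k≢h k∈ X (subst (_∈ˢ X) (s₁₃ u₁∈Y u₃∈Y) u₁∈X)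
  ... | inj₂ (inj₂ refl) = hub∉ k≢h k∈ X (subst (_∈ˢ X) (s₂₃ u₂∈Y u₃∈Y) u₂∈X)

  -- X false _ and X true _ are two pairs of spokes; the pair X true _ avoids C.
  record Quad (h : Fin n) {k} (C : Spoke k) : Set where
    field
      X       : Bool → Bool → Spoke h
      sep     : ∀ {s t} → s ≢ t → ∀ i j → Sep (X s i) (X t j)
      sepPair : ∀ s → Sep (X s false) (X s true)
      miss    : ∀ i → X true i ∥ˢ C

  -- The outer vertices `p`, `q` of `C` block at most two of the four or more spokes at `h`. So two
  -- spokes avoiding `C` are picked first, then two more that differ from these and from each other.
  quad : ∀ {h k} → h ∈ᵉ e₀ → k ∈ᵉ e₀ → h ≢ k → 5 ≤ degree G h → (C : Spoke k) → Quad h C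
  quad {h} {k} h∈ k∈ h≢k 5≤d C = record { X = X ; sep = sep ; sepPair = sepPair ; miss = miss }
    where
    oC : Others (edge C) k
    oC = others (edge C) (hub∈ C)
    open Others oC using (p; q; p∈; q∈)
    h≢ : ∀ {u} → u ∈ˢ C → h ≢ u
    h≢ u∈ refl = hub∉ h≢k h∈ C u∈
    4≤d : 4 ≤ degree G h
    4≤d = ℕ.≤-trans (ℕ.m≤m+n 4 1) 5≤d
    module P₃ = Pick (spoke h∈ (p ∷ q ∷ []) (h≢ p∈ ∷ h≢ q∈ ∷ []) 4≤d)
    module P₄ = Pick (spoke h∈ (p ∷ q ∷ P₃.mark ∷ []) (h≢ p∈ ∷ h≢ q∈ ∷ P₃.h≢mark ∷ []) 5≤d)
    module P₁ = Pick (spoke h∈ (P₃.mark ∷ P₄.mark ∷ []) (P₃.h≢mark ∷ P₄.h≢mark ∷ []) 4≤d)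
    module P₂ = Pick (spoke h∈ (P₃.mark ∷ P₄.mark ∷ P₁.mark ∷ []) (P₃.h≢mark ∷ P₄.h≢mark ∷ P₁.h≢mark ∷ []) 5≤d)
    X : Bool → Bool → Spoke h
    X false false = P₁.pick
    X false true  = P₂.pick
    X true  false = P₃.pick
    X true  true  = P₄.pick
    third : ∀ {P : Fin n → Set} {x y z} → All P (x ∷ y ∷ z ∷ []) → P z
    third (_ ∷ _ ∷ Pz ∷ []) = Pz
    sepPair : ∀ s → Sep (X s false) (X s true)
    sepPair false = sepBy (X false false) (X false true) (≢-sym P₁.h≢mark) P₁.mark∈ (third P₂.avoids)
    sepPair true  = sepBy (X true false) (X true true) (≢-sym P₃.h≢mark) P₃.mark∈ (third P₄.avoids)
    avoids₃ : ∀ j → P₃.mark ∉ˢ X false j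
    avoids₃ false = All.head P₁.avoids
    avoids₃ true  = All.head P₂.avoids
    avoids₄ : ∀ j → P₄.mark ∉ˢ X false j
    avoids₄ false = All.head (All.tail P₁.avoids)
    avoids₄ true  = All.head (All.tail P₂.avoids)
    sepTF : ∀ i j → Sep (X true i) (X false j)
    sepTF false j = sepBy (X true false) (X false j) (≢-sym P₃.h≢mark) P₃.mark∈ (avoids₃ j)
    sepTF true  j = sepBy (X true true) (X false j) (≢-sym P₄.h≢mark) P₄.mark∈ (avoids₄ j)
    sep : ∀ {s t} → s ≢ t → ∀ i j → Sep (X s i) (X t j)
    sep {false} {false} s≢t i j = contradiction refl s≢t
    sep {false} {true}  s≢t i j = sep-sym (X true j) (X false i) (sepTF j i)
    sep {true}  {false} s≢t i j = sepTF i j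
    sep {true}  {true}  s≢t i j = contradiction refl s≢t
    avoidsC : ∀ i → p ∉ˢ X true i × q ∉ˢ X true i
    avoidsC false = All.head P₃.avoids , All.head (All.tail P₃.avoids)
    avoidsC true  = All.head P₄.avoids , All.head (All.tail P₄.avoids)
    miss : ∀ i → X true i ∥ˢ C
    miss i u∈X u∈C = disjointBy (edge (X true i)) oC
      (hub∉ (≢-sym h≢k) k∈ (X true i)) (proj₁ (avoidsC i)) (proj₂ (avoidsC i)) u∈C u∈X

  module Hubs {a b c : Fin n} (a≢b : a ≢ b) (a≢c : a ≢ c) (b≢c : b ≢ c)
              (a∈ : a ∈ᵉ e₀) (b∈ : b ∈ᵉ e₀) (c∈ : c ∈ᵉ e₀) where

    crownless : (A : Spoke a) (B : Spoke b) (C : Spoke c) → A ∥ˢ B → A ∥ˢ C → B ∥ˢ C → ⊥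
    crownless A B C A∥B A∥C B∥C = free (crown e₀ (edge A) (edge B) (edge C)
      (a , a∈ , hub∈ A) (b , b∈ , hub∈ B) (c , c∈ , hub∈ C) A∥B A∥C B∥C)

    -- The two copies of K₄ are indexed by s; A s i and B s i are their edges in the links of a and b.
    record Blocks : Set where
      field
        A        : Bool → Bool → Spoke a
        B        : Bool → Bool → Spoke b
        sepA     : ∀ {s t} → s ≢ t → ∀ i j → Sep (A s i) (A t j)
        sepB     : ∀ {s t} → s ≢ t → ∀ i j → Sep (B s i) (B t j)
        sepPairA : ∀ s → Sep (A s false) (A s true)
        sepPairB : ∀ s → Sep (B s false) (B s true)
        miss     : ∀ {s t} → s ≢ t → ∀ i j → A s i ∥ˢ B t j

      -- The outer pair of `C` belongs to the K₄ with index `s`, where it crosses the perfect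
      -- matchings given by the links of `a` and `b`.
      record Kind (s : Bool) (C : Spoke c) : Set where
        field
          meetA : ∀ i → Meetˢ C (A s i)
          meetB : ∀ i → Meetˢ C (B s i)
          missA : ∀ {t} → s ≢ t → ∀ i → C ∥ˢ A t i
          missB : ∀ {t} → s ≢ t → ∀ i → C ∥ˢ B t i

      -- Meeting both A-edges of block `s` uses up the outer vertices of `C`, so `C` misses the
      -- A-edges of the other block. If it also missed `B s i`, these two and an A-edge of the other
      -- block would complete a crown. Hence it meets both B-edges of block `s`, and counting again
      -- gives `missB`.
      meetsA⇒Kind : ∀ s C → (∀ i → Meetˢ C (A s i)) → Kind s C
      meetsA⇒Kind s C meetA = record { meetA = meetA ; meetB = meetB ; missA = missA ; missB = missB }
        where
        missA : ∀ {t} → s ≢ t → ∀ i → C ∥ˢ A t i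
        missA {t} s≢t i u∈C u∈A = meetAtMostTwo a≢c c∈ a∈ C (A s false) (A s true) (A t i)
          (sepPairA s) (sepA s≢t false i) (sepA s≢t true i) (meetA false) (meetA true) (_ , u∈C , u∈A)
        meetB : ∀ i → Meetˢ C (B s i)
        meetB i with meet? (edge C) (edge (B s i))
        ... | inj₁ meets = meets
        ... | inj₂ C∥B   = ⊥-elim (crownless (A (not s) false) (B s i) C
          (miss (≢-sym (Bool.not-¬ refl)) false i)
          (∥-sym {edge C} {edge (A (not s) false)} (missA (Bool.not-¬ refl) false))
          (∥-sym {edge C} {edge (B s i)} C∥B))
        missB : ∀ {t} → s ≢ t → ∀ i → C ∥ˢ B t i
        missB {t} s≢t i u∈C u∈B = meetAtMostTwo b≢c c∈ b∈ C (B s false) (B s true) (B t i)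
          (sepPairB s) (sepB s≢t false i) (sepB s≢t true i) (meetB false) (meetB true) (_ , u∈C , u∈B)

      -- An A-edge missed by `C` forces `C` to meet every B-edge of the opposite block, else there
      -- is a crown. Applied to both blocks this yields four separated B-edges, of which three are
      -- already too many.
      missesBoth : ∀ C {i j} → C ∥ˢ A false i → C ∥ˢ A true j → ⊥
      missesBoth C {i} {j} C∥A₀ C∥A₁ = meetAtMostTwo b≢c c∈ b∈ C (B false false) (B false true) (B true false)
          (sepPairB false) (sepB (λ ()) false false) (sepB (λ ()) true false)
          (meets (λ ()) C∥A₁ false) (meets (λ ()) C∥A₁ true) (meets (λ ()) C∥A₀ false)
        where
        meets : ∀ {s t i} → s ≢ t → C ∥ˢ A s i → ∀ k → Meetˢ C (B t k)
        meets {s} {t} {i} s≢t C∥A k with meet? (edge C) (edge (B t k))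
        ... | inj₁ m   = m
        ... | inj₂ C∥B = ⊥-elim (crownless (A s i) (B t k) C (miss s≢t i k)
          (∥-sym {edge C} {edge (A s i)} C∥A) (∥-sym {edge C} {edge (B t k)} C∥B))

      kind : ∀ C → ∃[ s ] Kind s C
      kind C with meetsBoth? false | meetsBoth? true
        where
        meetsBoth? : ∀ s → (∀ i → Meetˢ C (A s i)) ⊎ ∃[ i ] C ∥ˢ A s i
        meetsBoth? s with meet? (edge C) (edge (A s false)) | meet? (edge C) (edge (A s true))
        ... | inj₁ m₀ | inj₁ m₁ = inj₁ λ { false → m₀ ; true → m₁ }
        ... | inj₂ d  | _       = inj₂ (false , d)
        ... | inj₁ _  | inj₂ d  = inj₂ (true , d)
      ... | inj₁ m₀       | _             = false , meetsA⇒Kind false C m₀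
      ... | inj₂ _        | inj₁ m₁       = true , meetsA⇒Kind true C m₁
      ... | inj₂ (i , d₀) | inj₂ (j , d₁) = ⊥-elim (missesBoth C {i} {j} d₀ d₁)

    -- The pairs with index `true` avoid `C`, so crown-freeness makes the A-edges and B-edges among
    -- them cross. Each of these edges then has both outer vertices used up and misses the pair with
    -- index `false` at the other hub.
    blocks : 5 ≤ degree G a → 5 ≤ degree G b → (C : Spoke c) → Blocks
    blocks 5≤da 5≤db C = record
      { A = A.X ; B = B.X ; sepA = A.sep ; sepB = B.sep ; sepPairA = A.sepPair ; sepPairB = B.sepPair
      ; miss = miss }
      where
      module A = Quad (quad a∈ c∈ a≢c 5≤da C)
      module B = Quad (quad b∈ c∈ b≢c 5≤db C)
      cross : ∀ i j → Meetˢ (A.X true i) (B.X true j)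
      cross i j with meet? (edge (A.X true i)) (edge (B.X true j))
      ... | inj₁ m   = m
      ... | inj₂ A∥B = ⊥-elim (crownless (A.X true i) (B.X true j) C A∥B (A.miss i) (B.miss j))
      miss : ∀ {s t} → s ≢ t → ∀ i j → A.X s i ∥ˢ B.X t j
      miss {false} {false} s≢t i j = contradiction refl s≢t
      miss {true}  {true}  s≢t i j = contradiction refl s≢t
      miss {true}  {false} s≢t i j u∈A u∈B =
        meetAtMostTwo (≢-sym a≢b) a∈ b∈ (A.X true i) (B.X true false) (B.X true true) (B.X false j)
          (B.sepPair true) (B.sep s≢t false j) (B.sep s≢t true j) (cross i false) (cross i true) (_ , u∈A , u∈B)
      miss {false} {true}  s≢t i j u∈A u∈B =
        meetAtMostTwo a≢b b∈ a∈ (B.X true j) (A.X true false) (A.X true true) (A.X false i)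
          (A.sepPair true) (A.sep (≢-sym s≢t) false i) (A.sep (≢-sym s≢t) true i)
          (Meet-sym {edge (A.X true false)} {edge (B.X true j)} (cross false j))
          (Meet-sym {edge (A.X true true)} {edge (B.X true j)} (cross true j)) (_ , u∈B , u∈A)

    -- One spoke at `c` of each kind, given by `K`, and a further spoke `E` of either kind.
    module Neighbours (𝔅 : Blocks) (K : Bool → Spoke c) (K-kind : ∀ s → Blocks.Kind 𝔅 s (K s))
                      (E : Spoke c) (E-sep : ∀ s → Sep E (K s)) where

      open Blocks 𝔅

      a∉B : ∀ s i → a ∉ˢ B s i
      a∉B s i = hub∉ a≢b a∈ (B s i)
      b∉A : ∀ s i → b ∉ˢ A s i
      b∉A s i = hub∉ (≢-sym a≢b) b∈ (A s i)
      c∉A : ∀ s i → c ∉ˢ A s i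
      c∉A s i = hub∉ (≢-sym a≢c) c∈ (A s i)
      a∉C : (C : Spoke c) → a ∉ˢ C
      a∉C = hub∉ a≢c a∈
      b∉C : (C : Spoke c) → b ∉ˢ C
      b∉C = hub∉ b≢c b∈

      s≢ : ∀ {s} → s ≢ not s
      s≢ = Bool.not-¬ refl

      sepA′ : ∀ s i → Sep (A s i) (A s (not i))
      sepA′ s false = sepPairA s
      sepA′ s true  = sep-sym (A s false) (A s true) (sepPairA s)
      sepB′ : ∀ s i → Sep (B s i) (B s (not i))
      sepB′ s false = sepPairB s
      sepB′ s true  = sep-sym (B s false) (B s true) (sepPairB s)

      -- Otherwise the C-edge `K (not s)` of the other block, which misses both edges, completes a
      -- crown.
      cross : ∀ s i j → Meetˢ (A s i) (B s j)
      cross s i j with meet? (edge (A s i)) (edge (B s j))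
      ... | inj₁ m   = m
      ... | inj₂ A∥B = ⊥-elim (crownless (A s i) (B s j) (K (not s)) A∥B
        (λ u∈A u∈K → Kind.missA (K-kind (not s)) (≢-sym s≢) i u∈K u∈A)
        (λ u∈B u∈K → Kind.missB (K-kind (not s)) (≢-sym s≢) j u∈K u∈B))

      -- The two B-edges of block `s` meet `A s i` in different vertices other than `a`, which are
      -- thus all its outer vertices.
      onB : ∀ s i {u} → u ∈ˢ A s i → u ≢ a → ∃[ j ] u ∈ˢ B s j
      onB s i u∈A u≢a with cross s i false | cross s i true
      ... | p , p∈A , p∈B | q , q∈A , q∈B
        with pigeonhole (edge (A s i)) (hub∈ (A s i)) u∈A p∈A q∈A u≢a
               (λ { refl → a∉B s false p∈B }) (λ { refl → a∉B s true q∈B })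
      ... | inj₁ refl        = false , p∈B
      ... | inj₂ (inj₁ refl) = true , q∈B
      ... | inj₂ (inj₂ refl) = ⊥-elim (b∉A s i (subst (_∈ˢ A s i) (sepPairB s p∈B q∈B) p∈A))

      apart : ∀ {h p q} (X : Spoke h) f → h ∉ᵉ f → p ∈ˢ X → p ∈ᵉ f → q ∈ˢ X → q ∈ᵉ f → p ≡ q
      apart {p = p} {q} X f h∉f p∈X p∈f q∈X q∈f with p Fin.≟ q
      ... | yes p≡q = p≡q
      ... | no p≢q  = contradiction (coincide (edge X) f p≢q p∈X q∈X p∈f q∈f (hub∈ X)) h∉f

      -- D is an edge at v outside the blocks.  Any C of kind s yields an edge J at w that avoids D and the A-edges
      -- of the other block; so D meets both of these A-edges, for otherwise A s i, J, D and one of them form a crown.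
      module FourthEdge (s i j : Bool) {v w : Fin n} (v≢a : v ≢ a)
                        (v∈A : v ∈ˢ A s i) (v∈B : v ∈ˢ B s j) (w∈A : w ∈ˢ A s i) (w∈B : w ∈ˢ B s (not j))
                        (D : Edge) (v∈D : v ∈ᵉ D) (a∉D : a ∉ᵉ D) (b∉D : b ∉ᵉ D) (c∉D : c ∉ᵉ D) where

        w≢a : w ≢ a
        w≢a w≡a = a∉B s (not j) (subst (_∈ˢ B s (not j)) w≡a w∈B)

        separated : ∀ {p q} → p ∈ˢ B s j → q ∈ˢ B s (not j) → p ≢ b → p ≢ q
        separated p∈ q∈ p≢b refl = p≢b (sepB′ s j p∈ q∈)

        v≢b : v ≢ b
        v≢b refl = b∉A s i v∈A

        v≢w : v ≢ w
        v≢w = separated v∈B w∈B v≢b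

        vOrW : ∀ (C : Spoke c) → Kind s C → v ∈ˢ C ⊎ w ∈ˢ C
        vOrW C k with Kind.meetA k i
        ... | u , u∈C , u∈A
          with cover (edge (A s i)) (≢-sym v≢a) (≢-sym w≢a) v≢w (hub∈ (A s i)) v∈A w∈A u∈A
        ... | inj₁ refl        = ⊥-elim (a∉C C u∈C)
        ... | inj₂ (inj₁ refl) = inj₁ u∈C
        ... | inj₂ (inj₂ refl) = inj₂ u∈C

        w∉D : w ∉ᵉ D
        w∉D w∈D = v≢w (apart (A s i) D a∉D v∈A v∈D w∈A w∈D)

        notBoth : (C : Spoke c) → v ∈ˢ C → w ∉ˢ C
        notBoth C v∈C w∈C = v≢w (apart (A s i) (edge C) (a∉C C) v∈A v∈C w∈A w∈C)

        jewel : (C : Spoke c) → Kind s C → ∃[ J ] w ∈ᵉ J × J ∥ D × ∀ k → J ∥ edge (A (not s) k)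
        jewel C k with vOrW C k | Kind.meetB k j | Kind.meetB k (not j)
        -- With `v` on `C`, take `B s (not j)`: its vertices are `b`, `w` and a point `z` of `C`.
        -- The edge `D` cannot contain `z`, since `v` and `z` already lie together on `C`.
        ... | inj₁ v∈C | _ | z , z∈C , z∈B =
          edge (B s (not j)) , w∈B , J∥D , λ l u∈B u∈A → miss (≢-sym s≢) l (not j) u∈A u∈B
          where
          J∥D : edge (B s (not j)) ∥ D
          J∥D u∈J u∈D
            with cover (edge (B s (not j))) (λ { refl → b∉A s i w∈A }) (λ { refl → b∉C C z∈C })
                   (λ { refl → notBoth C v∈C z∈C }) (hub∈ (B s (not j))) w∈B z∈B u∈J
          ... | inj₁ refl        = b∉D u∈D
          ... | inj₂ (inj₁ refl) = w∉D u∈D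
          ... | inj₂ (inj₂ refl) = separated v∈B z∈B v≢b (apart C D c∉D v∈C v∈D z∈C u∈D)
        -- With `w` on `C`, take `C` itself: its vertices are `c`, `w` and a point `z` of `B s j`.
        -- If `D` contained `z`, then `z` would be `v`, but `C` does not contain both `v` and `w`.
        ... | inj₂ w∈C | z , z∈C , z∈B | _ = edge C , w∈C , J∥D , λ l → Kind.missA k s≢ l
          where
          J∥D : edge C ∥ D
          J∥D u∈J u∈D
            with cover (edge C) (λ { refl → c∉A s i w∈A }) (λ { refl → hub∉ (≢-sym b≢c) c∈ (B s j) z∈B })
                   (≢-sym (separated z∈B w∈B (λ { refl → b∉C C z∈C }))) (hub∈ C) w∈C z∈C u∈J
          ... | inj₁ refl        = c∉D u∈D
          ... | inj₂ (inj₁ refl) = w∉D u∈D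
          ... | inj₂ (inj₂ refl) =
            notBoth C (subst (_∈ˢ C) (sym (apart (B s j) D b∉D v∈B v∈D z∈B u∈D)) z∈C) w∈C

        meetsD : ∀ k → Meet D (edge (A (not s) k))
        meetsD k with meet? D (edge (A (not s) k)) | jewel (K s) (K-kind s)
        ... | inj₁ m   | _                        = m
        ... | inj₂ D∥A | J , w∈J , J∥D , J∥A = ⊥-elim (free
          (crown (edge (A s i)) J D (edge (A (not s) k))
            (w , w∈A , w∈J) (v , v∈A , v∈D) (a , hub∈ (A s i) , hub∈ (A (not s) k)) J∥D (J∥A k) D∥A))

        -- D consists of v and two points of the other block, and so avoids the C-edges of that block.  Then no
        -- C-edge of block s contains v, which forces a second C-edge in the other block, and D meets one of the two.
        module Transversal (point : Bool → Fin n) (point∈D : ∀ k → point k ∈ᵉ D)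
                           (point∈A : ∀ k → point k ∈ˢ A (not s) k) where

          ∈D⇒≢a : ∀ {u} → u ∈ᵉ D → u ≢ a
          ∈D⇒≢a u∈D refl = a∉D u∈D

          separatedA : ∀ k {p q} → p ∈ˢ A (not s) k → q ∈ˢ A (not s) (not k) → p ≢ a → p ≢ q
          separatedA k p∈ q∈ p≢a refl = p≢a (sepA′ (not s) k p∈ q∈)

          coverD : ∀ {u} → u ∈ᵉ D → u ≡ v ⊎ ∃[ k ] u ≡ point k
          coverD u∈D
            with cover D (λ v≡x → v≢a (sepA s≢ i false v∈A (subst (_∈ˢ A (not s) false) (sym v≡x) (point∈A false))))
                         (λ v≡y → v≢a (sepA s≢ i true v∈A (subst (_∈ˢ A (not s) true) (sym v≡y) (point∈A true))))
                         (separatedA false (point∈A false) (point∈A true) (∈D⇒≢a (point∈D false)))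
                         v∈D (point∈D false) (point∈D true) u∈D
          ... | inj₁ u≡v        = inj₁ u≡v
          ... | inj₂ (inj₁ u≡x) = inj₂ (false , u≡x)
          ... | inj₂ (inj₂ u≡y) = inj₂ (true , u≡y)

          -- Let `C` pass through `point k`, and let `y′` be its vertex on the opposite A-edge. Of
          -- `point k`, `point (not k)` and `y′`, two lie on the same B-edge. If `point k` is one of
          -- them, that B-edge shares two vertices with `D` or with `C`; otherwise `y′` is
          -- `point (not k)`, and `C` shares two vertices with `D`.
          point∉ : (C : Spoke c) → Kind (not s) C → ∀ k → point k ∉ˢ C
          point∉ C kC k x∈C
            with Kind.meetA kC (not k)
          ... | y′ , y′∈C , y′∈A
            with onB (not s) k (point∈A k) (∈D⇒≢a (point∈D k))
               | onB (not s) (not k) (point∈A (not k)) (∈D⇒≢a (point∈D (not k)))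
               | onB (not s) (not k) y′∈A (λ { refl → a∉C C y′∈C })
          ... | l , x∈B | l′ , y∈B | l″ , y′∈B with twoOfThree l l′ l″
          ... | inj₁ refl = separatedA k (point∈A k) (point∈A (not k)) (∈D⇒≢a (point∈D k))
            (apart (B (not s) l) D b∉D x∈B (point∈D k) y∈B (point∈D (not k)))
          ... | inj₂ (inj₁ refl) = separatedA k (point∈A k) y′∈A (∈D⇒≢a (point∈D k))
            (apart (B (not s) l) (edge C) (b∉C C) x∈B x∈C y′∈B y′∈C)
          ... | inj₂ (inj₂ refl) = separatedA k (point∈A k) (point∈A (not k)) (∈D⇒≢a (point∈D k))
            (apart C D c∉D x∈C (point∈D k) y∈C (point∈D (not k)))
            where
            y∈C : point (not k) ∈ˢ C
            y∈C = subst (_∈ˢ C) (sym (apart (B (not s) l′) (edge (A (not s) (not k))) (b∉A (not s) (not k))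
              y∈B (point∈A (not k)) y′∈B y′∈A)) y′∈C

          missD : (C : Spoke c) → Kind (not s) C → D ∥ edge C
          missD C kC u∈D u∈C with coverD u∈D
          ... | inj₁ refl       = Kind.missA kC (≢-sym s≢) i u∈C v∈A
          ... | inj₂ (k , refl) = point∉ C kC k u∈C

          -- Otherwise `C` is the base of a crown with `D` at `v`, `K (not s)` at `c` and
          -- `A s (not i)` at the remaining vertex.
          v∉Kind : (C : Spoke c) → Kind s C → v ∉ˢ C
          v∉Kind C kC v∈C = free (crown (edge C) D (edge (K (not s))) (edge (A s (not i)))
            (v , v∈C , v∈D) (c , hub∈ C , hub∈ (K (not s))) (Kind.meetA kC (not i))
            (missD (K (not s)) (K-kind (not s))) D∥A (Kind.missA (K-kind (not s)) (≢-sym s≢) (not i)))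
            where
            D∥A : D ∥ edge (A s (not i))
            D∥A u∈D u∈A with coverD u∈D
            ... | inj₁ refl       = v≢a (sepA′ s i v∈A u∈A)
            ... | inj₂ (k , refl) = ∈D⇒≢a u∈D (sepA s≢ (not i) k u∈A (point∈A k))

          impossible : ⊥
          impossible with vOrW (K s) (K-kind s) | kind E
          ... | inj₁ v∈K | _ = v∉Kind (K s) (K-kind s) v∈K
          ... | inj₂ w∈K | t , kE with t Bool.≟ s
          ...   | yes refl with vOrW E kE
          ...     | inj₁ v∈E = v∉Kind E kE v∈E
          ...     | inj₂ w∈E = c∉A s i (subst (_∈ˢ A s i) (E-sep s w∈E w∈K) w∈A)
          impossible | inj₂ w∈K | t , kE | no t≢s with Bool.¬-not t≢s
          -- Here `D`, `E` and `K (not s)` all meet the same A-edge outside `a`, where it has only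
          -- two vertices.
          ... | refl with Kind.meetA kE false | Kind.meetA (K-kind (not s)) false
          ... | p , p∈E , p∈A | q , q∈K , q∈A
            with pigeonhole (edge (A (not s) false)) (hub∈ (A (not s) false)) (point∈A false) p∈A q∈A
                   (∈D⇒≢a (point∈D false)) (λ { refl → a∉C E p∈E }) (λ { refl → a∉C (K (not s)) q∈K })
          ... | inj₁ x≡p         = point∉ E kE false (subst (_∈ˢ E) (sym x≡p) p∈E)
          ... | inj₂ (inj₁ x≡q)  = point∉ (K (not s)) (K-kind (not s)) false (subst (_∈ˢ K (not s)) (sym x≡q) q∈K)
          ... | inj₂ (inj₂ refl) = c∉A (not s) false (subst (_∈ˢ A (not s) false) (E-sep (not s) p∈E q∈K) p∈A)

      -- At most three edges at `v` pass through `a`, `b` or `c`, so degree 4 would supply an edge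
      -- `D` missing all three.
      degree≤3 : ∀ s i {v} → v ∈ˢ A s i → v ≢ a → degree G v ≤ 3
      degree≤3 s i {v} v∈A v≢a with 4 ℕ.≤? degree G v
      ... | no d≱4 = ℕ.≤-pred (ℕ.≰⇒> d≱4)
      ... | yes 4≤d
        with avoid v (a ∷ b ∷ c ∷ []) (v≢a ∷ (λ { refl → b∉A s i v∈A }) ∷ (λ { refl → c∉A s i v∈A }) ∷ []) 4≤d
      ... | D , v∈D , a∉D ∷ b∉D ∷ c∉D ∷ [] =
        let j , v∈B = onB s i v∈A v≢a
            w , w∈A , w∈B = cross s i (not j)
            open FourthEdge s i j v≢a v∈A v∈B w∈A w∈B D v∈D a∉D b∉D c∉D
        in ⊥-elim (Transversal.impossible (proj₁ ∘ meetsD) (proj₁ ∘ proj₂ ∘ meetsD) (proj₂ ∘ proj₂ ∘ meetsD))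

      -- The degree of `a` is only bounded below, so a fifth spoke `X` must be excluded. It would
      -- miss both `K s`, whose outer vertices lie on A-edges of their blocks, and then
      -- crown-freeness would make it meet every B-edge.
      inBlock : ∀ (X : Spoke a) {v} → v ∈ˢ X → v ≢ a → ∃[ s ] ∃[ i ] v ∈ˢ A s i
      inBlock X {v} v∈X v≢a with found? false | found? true
        where
        found? : ∀ s → (∃[ i ] v ∈ˢ A s i) ⊎ ∀ i → Sep X (A s i)
        found? s with v ∈? proj₁ (edge (A s false)) | v ∈? proj₁ (edge (A s true))
        ... | yes v∈ | _      = inj₁ (false , v∈)
        ... | no _   | yes v∈ = inj₁ (true , v∈)
        ... | no v∉₀ | no v∉₁ = inj₂ λ
          { false → sepBy X (A s false) v≢a v∈X v∉₀ ; true → sepBy X (A s true) v≢a v∈X v∉₁ }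
      ... | inj₁ (i , v∈) | _ = false , i , v∈
      ... | inj₂ _ | inj₁ (i , v∈) = true , i , v∈
      ... | inj₂ sep₀ | inj₂ sep₁ = ⊥-elim (meetAtMostTwo (≢-sym a≢b) a∈ b∈ X
          (B false false) (B false true) (B true false) (sepPairB false) (sepB (λ ()) false false) (sepB (λ ()) true false)
          (meets false false) (meets false true) (meets true false))
        where
        sepX : ∀ s i → Sep X (A s i)
        sepX false = sep₀
        sepX true  = sep₁
        X∥K : ∀ s → X ∥ˢ K s
        X∥K s u∈X u∈K = meetAtMostTwo a≢c c∈ a∈ (K s) (A s false) (A s true) X
          (sepPairA s) (sep-sym X (A s false) (sepX s false)) (sep-sym X (A s true) (sepX s true))
          (Kind.meetA (K-kind s) false) (Kind.meetA (K-kind s) true) (_ , u∈K , u∈X)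
        meets : ∀ s j → Meetˢ X (B s j)
        meets s j with meet? (edge X) (edge (B s j))
        ... | inj₁ m   = m
        ... | inj₂ X∥B = ⊥-elim (crownless X (B s j) (K (not s)) X∥B (X∥K (not s))
          (λ u∈B u∈K → Kind.missB (K-kind (not s)) (≢-sym s≢) j u∈K u∈B))

    -- Three spokes at `c` of one kind would meet a single A-edge in three distinct outer vertices.
    -- So among three spokes two have different kinds and serve as `K`, and the third serves as `E`.
    neighbours≤3 : 5 ≤ degree G a → 5 ≤ degree G b → 4 ≤ degree G c →
      ∀ (X : Spoke a) {v} → v ∈ˢ X → v ≢ a → degree G v ≤ 3
    neighbours≤3 5≤da 5≤db 4≤dc X v∈X v≢a = arrange (kind C₁) (kind C₂) (kind C₃)
      where
      module P₁ = Pick (spoke c∈ [] [] (ℕ.≤-trans (ℕ.m≤m+n 2 2) 4≤dc))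
      module P₂ = Pick (spoke c∈ (P₁.mark ∷ []) (P₁.h≢mark ∷ []) (ℕ.≤-trans (ℕ.m≤m+n 3 1) 4≤dc))
      module P₃ = Pick (spoke c∈ (P₁.mark ∷ P₂.mark ∷ []) (P₁.h≢mark ∷ P₂.h≢mark ∷ []) 4≤dc)
      C₁ C₂ C₃ : Spoke c
      C₁ = P₁.pick
      C₂ = P₂.pick
      C₃ = P₃.pick
      sep₁₂ : Sep C₁ C₂
      sep₁₂ = sepBy C₁ C₂ (≢-sym P₁.h≢mark) P₁.mark∈ (All.head P₂.avoids)
      sep₁₃ : Sep C₁ C₃
      sep₁₃ = sepBy C₁ C₃ (≢-sym P₁.h≢mark) P₁.mark∈ (All.head P₃.avoids)
      sep₂₃ : Sep C₂ C₃
      sep₂₃ = sepBy C₂ C₃ (≢-sym P₂.h≢mark) P₂.mark∈ (All.head (All.tail P₃.avoids))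

      𝔅 : Blocks
      𝔅 = blocks 5≤da 5≤db C₁
      open Blocks 𝔅

      allSame : ∀ {s} → Kind s C₁ → Kind s C₂ → Kind s C₃ → ⊥
      allSame {s} k₁ k₂ k₃ = meetAtMostTwo (≢-sym a≢c) a∈ c∈ (A s false) C₁ C₂ C₃ sep₁₂ sep₁₃ sep₂₃
        (flip C₁ k₁) (flip C₂ k₂) (flip C₃ k₃)
        where
        flip : ∀ C → Kind s C → Meetˢ (A s false) C
        flip C k = Meet-sym {edge C} {edge (A s false)} (Kind.meetA k false)

      conclude : ∀ {s} (C C′ E : Spoke c) → Kind s C → Kind (not s) C′ → Sep E C → Sep E C′ → degree G _ ≤ 3
      conclude {s} C C′ E kC kC′ sepC sepC′ =
        let t , i , v∈A = inBlock X v∈X v≢a in degree≤3 t i v∈A v≢a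
        where
        choice : ∀ t → ∃[ C ] Kind t C × Sep E C
        choice t with t Bool.≟ s
        ... | yes refl = C , kC , sepC
        ... | no t≢s   = C′ , subst (λ t → Kind t C′) (sym (Bool.¬-not t≢s)) kC′ , sepC′
        open Neighbours 𝔅 (λ t → proj₁ (choice t)) (λ t → proj₁ (proj₂ (choice t))) E (λ t → proj₂ (proj₂ (choice t)))

      arrange : ∃[ s ] Kind s C₁ → ∃[ s ] Kind s C₂ → ∃[ s ] Kind s C₃ → degree G _ ≤ 3
      arrange (s₁ , k₁) (s₂ , k₂) (s₃ , k₃) with s₂ Bool.≟ s₁ | s₃ Bool.≟ s₁
      ... | yes refl | yes refl = ⊥-elim (allSame k₁ k₂ k₃)
      ... | no s₂≢s₁ | _        = conclude C₁ C₂ C₃ k₁ (subst (λ t → Kind t C₂) (Bool.¬-not s₂≢s₁) k₂)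
        (sep-sym C₁ C₃ sep₁₃) (sep-sym C₂ C₃ sep₂₃)
      ... | yes _    | no s₃≢s₁ = conclude C₁ C₃ C₂ k₁ (subst (λ t → Kind t C₃) (Bool.¬-not s₃≢s₁) k₃)
        (sep-sym C₁ C₂ sep₁₂) sep₂₃

-- Discharging

sum-map-≤ : ∀ {A : Set} (f : A → ℕ) β xs → (∀ {x} → x ∈ᴸ xs → f x ≤ β) → sum (map f xs) ≤ length xs *ℕ β
sum-map-≤ f β []       f≤β = z≤n
sum-map-≤ f β (x ∷ xs) f≤β = ℕ.+-mono-≤ (f≤β (here refl)) (sum-map-≤ f β xs (f≤β ∘ there))

sum-map-≥ : ∀ {A : Set} (f : A → ℕ) β xs → (∀ {x} → x ∈ᴸ xs → β ≤ f x) → length xs *ℕ β ≤ sum (map f xs)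
sum-map-≥ f β []       β≤f = z≤n
sum-map-≥ f β (x ∷ xs) β≤f = ℕ.+-mono-≤ (β≤f (here refl)) (sum-map-≥ f β xs (β≤f ∘ there))

-- A subtraction-free form of the bound `α` for one entry and `β` for each of the others.
sum-map-exceptOne : ∀ {A : Set} (f : A → ℕ) α β {xs x} → Unique xs → x ∈ᴸ xs → f x ≤ α →
  (∀ {y} → y ∈ᴸ xs → y ≢ x → f y ≤ β) → β + sum (map f xs) ≤ α + length xs *ℕ β
sum-map-exceptOne f α β {x ∷ xs} (x≢xs ∷ _) (here refl) fx≤α f≤β = begin
  β + (f x + sum (map f xs))   ≡⟨ solve 3 (λ b x s → b :+ (x :+ s) := x :+ (b :+ s)) refl β (f x) _ ⟩
  f x + (β + sum (map f xs))   ≤⟨ ℕ.+-mono-≤ fx≤α (ℕ.+-monoʳ-≤ β (sum-map-≤ f β xs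
                                    λ y∈ → f≤β (there y∈) (≢-sym (All.lookup x≢xs y∈)))) ⟩
  α + (β + length xs *ℕ β)     ∎
  where open ℕ.≤-Reasoning
sum-map-exceptOne f α β {y ∷ xs} (y≢xs ∷ xs!) (there x∈) fx≤α f≤β = begin
  β + (f y + sum (map f xs))   ≡⟨ solve 3 (λ b x s → b :+ (x :+ s) := x :+ (b :+ s)) refl β (f y) _ ⟩
  f y + (β + sum (map f xs))   ≤⟨ ℕ.+-mono-≤ (f≤β (here refl) (All.lookup y≢xs x∈))
                                    (sum-map-exceptOne f α β xs! x∈ fx≤α (f≤β ∘ there)) ⟩
  β + (α + length xs *ℕ β)     ≡⟨ solve 3 (λ b x s → b :+ (x :+ s) := x :+ (b :+ s)) refl β α _ ⟩
  α + (β + length xs *ℕ β)     ∎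
  where open ℕ.≤-Reasoning

sum-map-filter : ∀ {A : Set} {P : A → Set} (P? : Decidable P) (f : A → ℕ) β xs →
  (∀ x → f x ≤ β) → (∀ {x} → P x → f x ≡ 0) →
  sum (map f xs) + length (filter P? xs) *ℕ β ≤ length xs *ℕ β
sum-map-filter P? f β []       f≤β f≡0 = z≤n
sum-map-filter P? f β (x ∷ xs) f≤β f≡0 with P? x
... | yes Px rewrite f≡0 Px = begin
  S + (β + L)   ≡⟨ solve 3 (λ s b l → s :+ (b :+ l) := b :+ (s :+ l)) refl S β L ⟩
  β + (S + L)   ≤⟨ ℕ.+-monoʳ-≤ β (sum-map-filter P? f β xs f≤β f≡0) ⟩
  β + length xs *ℕ β ∎
  where
  open ℕ.≤-Reasoning
  S = sum (map f xs)
  L = length (filter P? xs) *ℕ β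
... | no _ = begin
  f x + S + L   ≡⟨ ℕ.+-assoc (f x) S L ⟩
  f x + (S + L) ≤⟨ ℕ.+-mono-≤ (f≤β x) (sum-map-filter P? f β xs f≤β f≡0) ⟩
  β + length xs *ℕ β ∎
  where
  open ℕ.≤-Reasoning
  S = sum (map f xs)
  L = length (filter P? xs) *ℕ β

-- Double counting

module _ {A B : Set} {R : A → B → Set} (R? : ∀ x y → Dec (R x y)) (F : A → B → ℕ) where

  row : List B → A → ℕ
  row ys x = sum (map (F x) (filter (R? x) ys))

  column : List A → B → ℕ
  column xs y = sum (map (λ x → F x y) (filter (λ x → R? x y) xs))

  sum-row-∷ : ∀ xs y ys → sum (map (row (y ∷ ys)) xs) ≡ column xs y + sum (map (row ys) xs)
  sum-row-∷ []       y ys = refl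
  sum-row-∷ (x ∷ xs) y ys with does (R? x y)
  ... | false rewrite sum-row-∷ xs y ys =
    solve 3 (λ a b c → a :+ (b :+ c) := b :+ (a :+ c)) refl (row ys x) (column xs y) (sum (map (row ys) xs))
  ... | true rewrite sum-row-∷ xs y ys =
    solve 4 (λ f a b c → (f :+ a) :+ (b :+ c) := (f :+ b) :+ (a :+ c)) refl
      (F x y) (row ys x) (column xs y) (sum (map (row ys) xs))

  sum-row≡sum-column : ∀ xs ys → sum (map (row ys) xs) ≡ sum (map (column xs) ys)
  sum-row≡sum-column xs []       = ℕ.n≤0⇒n≡0 (ℕ.≤-trans (sum-map-≤ (row []) 0 xs (λ _ → z≤n))
    (ℕ.≤-reflexive (ℕ.*-zeroʳ (length xs))))
  sum-row≡sum-column xs (y ∷ ys) =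
    trans (sum-row-∷ xs y ys) (cong (λ m → column xs y + m) (sum-row≡sum-column xs ys))

-- The sum of the codes of the three degrees on an edge is at least 7 iff one of them is at least 6; it is 5 or 6
-- iff they are (5, 5, 4) or (5, 5, 5), and at most 2 on an edge with degrees (5, ≤3, ≤3).
code : ℕ → ℕ
code 4                                         = 1
code 5                                         = 2
code (suc (suc (suc (suc (suc (suc _))))))     = 7
code _                                         = 0

-- The value 7 is for edges with a vertex of degree at least 6; two such shares and one of 6 make
-- 20.
share₃ : ℕ → ℕ
share₃ (suc (suc (suc (suc (suc (suc (suc _))))))) = 7
share₃ _                                           = 6

-- The vertex of degree 5 itself contributes 2 to the code sum. At 2 the other vertices have degree
-- at most 3, at 5 and 6 the edge is heavy, and 4 is the even split.
share₅ : ℕ → ℕ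
share₅ 0 = 3
share₅ 1 = 3
share₅ 2 = 3
share₅ 5 = 8
share₅ 6 = 8
share₅ _ = 4

-- share d t is what a vertex of degree d hands, out of its total of 20, to an edge with code sum t.
share : ℕ → ℕ → ℕ
share 0 t = 20
share 1 t = 20
share 2 t = 10
share 3 t = share₃ t
share 4 t = 5
share 5 t = share₅ t
share (suc (suc (suc (suc (suc (suc _)))))) t = 0

share₃≤7 : ∀ t → share₃ t ≤ 7
share₃≤7 0 = ℕ.n≤1+n 6
share₃≤7 1 = ℕ.n≤1+n 6
share₃≤7 2 = ℕ.n≤1+n 6
share₃≤7 3 = ℕ.n≤1+n 6
share₃≤7 4 = ℕ.n≤1+n 6
share₃≤7 5 = ℕ.n≤1+n 6
share₃≤7 6 = ℕ.n≤1+n 6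
share₃≤7 (suc (suc (suc (suc (suc (suc (suc _))))))) = ℕ.≤-refl

share₃≤6 : ∀ {t} → t ≤ 6 → share₃ t ≤ 6
share₃≤6 {0} _ = ℕ.≤-refl
share₃≤6 {1} _ = ℕ.≤-refl
share₃≤6 {2} _ = ℕ.≤-refl
share₃≤6 {3} _ = ℕ.≤-refl
share₃≤6 {4} _ = ℕ.≤-refl
share₃≤6 {5} _ = ℕ.≤-refl
share₃≤6 {6} _ = ℕ.≤-refl
share₃≤6 {suc (suc (suc (suc (suc (suc (suc _))))))} (s≤s (s≤s (s≤s (s≤s (s≤s (s≤s ()))))))

share₅≤8 : ∀ t → share₅ t ≤ 8
share₅≤8 0 = ℕ.m≤m+n 3 5
share₅≤8 1 = ℕ.m≤m+n 3 5
share₅≤8 2 = ℕ.m≤m+n 3 5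
share₅≤8 3 = ℕ.m≤m+n 4 4
share₅≤8 4 = ℕ.m≤m+n 4 4
share₅≤8 5 = ℕ.≤-refl
share₅≤8 6 = ℕ.≤-refl
share₅≤8 (suc (suc (suc (suc (suc (suc (suc _))))))) = ℕ.m≤m+n 4 4

Heavy : ℕ → Set
Heavy t = 5 ≤ t × t ≤ 6

share₅≤4 : ∀ {t} → ¬ Heavy t → share₅ t ≤ 4
share₅≤4 {0} _ = ℕ.n≤1+n 3
share₅≤4 {1} _ = ℕ.n≤1+n 3
share₅≤4 {2} _ = ℕ.n≤1+n 3
share₅≤4 {3} _ = ℕ.≤-refl
share₅≤4 {4} _ = ℕ.≤-refl
share₅≤4 {5} ¬h = contradiction (ℕ.≤-refl , ℕ.n≤1+n 5) ¬h
share₅≤4 {6} ¬h = contradiction (ℕ.n≤1+n 5 , ℕ.≤-refl) ¬h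
share₅≤4 {suc (suc (suc (suc (suc (suc (suc _))))))} _ = ℕ.≤-refl

code≤2 : ∀ {d} → d < 6 → code d ≤ 2
code≤2 {0} _ = z≤n
code≤2 {1} _ = z≤n
code≤2 {2} _ = z≤n
code≤2 {3} _ = z≤n
code≤2 {4} _ = ℕ.n≤1+n 1
code≤2 {5} _ = ℕ.≤-refl
code≤2 {suc (suc (suc (suc (suc (suc _)))))} (s≤s (s≤s (s≤s (s≤s (s≤s (s≤s ()))))))

code≡0 : ∀ {d} → d ≤ 3 → code d ≡ 0
code≡0 {0} _ = refl
code≡0 {1} _ = refl
code≡0 {2} _ = refl
code≡0 {3} _ = refl
code≡0 {suc (suc (suc (suc _)))} (s≤s (s≤s (s≤s ())))

-- Reduction of the weight inequalities to finitely many degrees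

-- Both `code` and `share` are constant from degree 6 on, so a check over `Fin 7` suffices; `cut≤`
-- carries lower bounds back to the true degree.
record Truncation (d : ℕ) : Set where
  field
    cut     : Fin 7
    cut≤    : toℕ cut ≤ d
    code-≡  : code (toℕ cut) ≡ code d
    share-≡ : ∀ t → share (toℕ cut) t ≡ share d t

truncate : ∀ d → Truncation d
truncate 0 = record { cut = # 0 ; cut≤ = ℕ.≤-refl ; code-≡ = refl ; share-≡ = λ _ → refl }
truncate 1 = record { cut = # 1 ; cut≤ = ℕ.≤-refl ; code-≡ = refl ; share-≡ = λ _ → refl }
truncate 2 = record { cut = # 2 ; cut≤ = ℕ.≤-refl ; code-≡ = refl ; share-≡ = λ _ → refl }
truncate 3 = record { cut = # 3 ; cut≤ = ℕ.≤-refl ; code-≡ = refl ; share-≡ = λ _ → refl }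
truncate 4 = record { cut = # 4 ; cut≤ = ℕ.≤-refl ; code-≡ = refl ; share-≡ = λ _ → refl }
truncate 5 = record { cut = # 5 ; cut≤ = ℕ.≤-refl ; code-≡ = refl ; share-≡ = λ _ → refl }
truncate (suc (suc (suc (suc (suc (suc d)))))) =
  record { cut = # 6 ; cut≤ = ℕ.m≤m+n 6 d ; code-≡ = refl ; share-≡ = λ _ → refl }

Exceeds : ℕ → ℕ → ℕ → Set
Exceeds i j k = 6 ≤ i × 4 ≤ j × 2 ≤ k

exceeds? : ∀ i j k → Dec (Exceeds i j k)
exceeds? i j k = 6 ℕ.≤? i ×-dec 4 ℕ.≤? j ×-dec 2 ℕ.≤? k

ExceedsSomeOrder : ℕ → ℕ → ℕ → Set
ExceedsSomeOrder i j k =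
  Exceeds i j k ⊎ Exceeds i k j ⊎ Exceeds j i k ⊎ Exceeds j k i ⊎ Exceeds k i j ⊎ Exceeds k j i

received : ℕ → ℕ → ℕ → ℕ
received i j k = let t = code i + (code j + code k) in share i t + (share j t + share k t)

received-cut : ∀ (i j k : Fin 7) →
  14 ≤ received (toℕ i) (toℕ j) (toℕ k) ⊎ ExceedsSomeOrder (toℕ i) (toℕ j) (toℕ k)
received-cut = toWitness {a? = Fin.all? λ i → Fin.all? λ j → Fin.all? λ k → check (toℕ i) (toℕ j) (toℕ k)} _
  where
  check : ∀ i j k → Dec (14 ≤ received i j k ⊎ ExceedsSomeOrder i j k)
  check i j k = 14 ℕ.≤? received i j k ⊎-dec exceeds? i j k ⊎-dec exceeds? i k j ⊎-dec
    exceeds? j i k ⊎-dec exceeds? j k i ⊎-dec exceeds? k i j ⊎-dec exceeds? k j i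

received-≥14 : ∀ i j k → 14 ≤ received i j k ⊎ ExceedsSomeOrder i j k
received-≥14 i j k = Sum.map
  (subst (14 ≤_) (cong₂ _+_ (shares (truncate i)) (cong₂ _+_ (shares (truncate j)) (shares (truncate k)))))
  (Sum.map (lift I.cut≤ J.cut≤ K.cut≤) (Sum.map (lift I.cut≤ K.cut≤ J.cut≤)
    (Sum.map (lift J.cut≤ I.cut≤ K.cut≤) (Sum.map (lift J.cut≤ K.cut≤ I.cut≤)
      (Sum.map (lift K.cut≤ I.cut≤ J.cut≤) (lift K.cut≤ J.cut≤ I.cut≤))))))
  (received-cut I.cut J.cut K.cut)
  where
  module I = Truncation (truncate i)
  module J = Truncation (truncate j)
  module K = Truncation (truncate k)
  codes : code (toℕ I.cut) + (code (toℕ J.cut) + code (toℕ K.cut)) ≡ code i + (code j + code k)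
  codes = cong₂ _+_ I.code-≡ (cong₂ _+_ J.code-≡ K.code-≡)
  shares : ∀ {d} (T : Truncation d) → let c = toℕ (Truncation.cut T) in
    share c (code (toℕ I.cut) + (code (toℕ J.cut) + code (toℕ K.cut))) ≡ share d (code i + (code j + code k))
  shares T = trans (cong (share (toℕ (Truncation.cut T))) codes) (Truncation.share-≡ T (code i + (code j + code k)))
  lift : ∀ {i j k i′ j′ k′} → i ≤ i′ → j ≤ j′ → k ≤ k′ → Exceeds i j k → Exceeds i′ j′ k′
  lift i≤ j≤ k≤ (6≤i , 4≤j , 2≤k) = ℕ.≤-trans 6≤i i≤ , ℕ.≤-trans 4≤j j≤ , ℕ.≤-trans 2≤k k≤

-- The summand 2 is the code of a vertex of degree 5. The other two codes then total 3 or 4, which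
-- leaves only 1 and 2, or 2 and 2.
heavyPair-cut : ∀ (i j : Fin 7) → Heavy (2 + (code (toℕ i) + code (toℕ j))) →
  (5 ≤ toℕ i × 4 ≤ toℕ j) ⊎ (5 ≤ toℕ j × 4 ≤ toℕ i)
heavyPair-cut = toWitness {a? = Fin.all? λ i → Fin.all? λ j →
  (5 ℕ.≤? 2 + (code (toℕ i) + code (toℕ j)) ×-dec 2 + (code (toℕ i) + code (toℕ j)) ℕ.≤? 6) →-dec
  ((5 ℕ.≤? toℕ i ×-dec 4 ℕ.≤? toℕ j) ⊎-dec (5 ℕ.≤? toℕ j ×-dec 4 ℕ.≤? toℕ i))} _

heavyPair : ∀ {i j} → Heavy (2 + (code i + code j)) → (5 ≤ i × 4 ≤ j) ⊎ (5 ≤ j × 4 ≤ i)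
heavyPair {i} {j} h =
  Sum.map (λ (5≤ , 4≤) → ℕ.≤-trans 5≤ I.cut≤ , ℕ.≤-trans 4≤ J.cut≤)
          (λ (5≤ , 4≤) → ℕ.≤-trans 5≤ J.cut≤ , ℕ.≤-trans 4≤ I.cut≤)
    (heavyPair-cut I.cut J.cut (subst (λ s → Heavy (2 + s)) (sym (cong₂ _+_ I.code-≡ J.code-≡)) h))
  where
  module I = Truncation (truncate i)
  module J = Truncation (truncate j)

-- Charges given by vertices and received by edges

module Discharging {n : ℕ} (G : Linear3Graph n) (free : CrownFree G)
                   (s≤2 : countDegreeAtLeast 6 G ≤ 2) where

  open Edges G

  codeSum : Subset n → ℕ
  codeSum e = sum (map (code ∘ degree G) (elements e))

  -- The degree is a separate argument so that `share d` reduces once `d` is a numeral.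
  given : ∀ d v → ℕ
  given d v = sum (map (share d ∘ codeSum) (edgesAt v))

  given≤length* : ∀ d v β → (∀ {e} → e ∈ᴸ edgesAt v → share d (codeSum e) ≤ β) → given d v ≤ degree G v *ℕ β
  given≤length* d v β = sum-map-≤ (share d ∘ codeSum) β (edgesAt v)

  edgesAt-unique : ∀ v → Unique (edgesAt v)
  edgesAt-unique v = Unique.filter⁺ (v ∈?_) (edges-unique G)

  -- At most two vertices have degree at least 6, so one of the three edges at `v` avoids them all.
  -- Its codes are at most 2 each, so it takes 6, and the other two edges take at most 7.
  given₃≤20 : ∀ v → degree G v ≡ 3 → given 3 v ≤ 20
  given₃≤20 v d≡3
    with avoid v (filter (λ u → 6 ℕ.≤? degree G u) (allFin n))
           (All.tabulate λ u∈ → λ { refl → small (proj₂ (∈-filter⁻ (λ u → 6 ℕ.≤? degree G u) {xs = allFin n} u∈)) })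
           (subst (countDegreeAtLeast 6 G <_) (sym d≡3) (s≤s s≤2))
    where
    small : ¬ 6 ≤ degree G v
    small 6≤d with subst (6 ≤_) d≡3 6≤d
    ... | s≤s (s≤s (s≤s ()))
  ... | e , v∈e , big∉e = ℕ.+-cancelˡ-≤ 7 _ 20
    (subst (λ d → 7 + given 3 v ≤ 6 + d *ℕ 7) d≡3
      (sum-map-exceptOne (share 3 ∘ codeSum) 6 7 (edgesAt-unique v) (∈-filter⁺ (v ∈?_) (proj₂ e) v∈e)
        (share₃≤6 codeSum≤6) (λ _ _ → share₃≤7 _)))
    where
    open Others (others e v∈e)
    light : ∀ {u} → u ∈ᵉ e → code (degree G u) ≤ 2
    light {u} u∈e = code≤2 (ℕ.≰⇒> λ 6≤d →
      All.lookup big∉e (∈-filter⁺ (λ u → 6 ℕ.≤? degree G u) (∈-allFin u) 6≤d) u∈e)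
    codeSum≤6 : codeSum (proj₁ e) ≤ 6
    codeSum≤6 = subst (_≤ 6) (sym (total (code ∘ degree G)))
      (ℕ.+-mono-≤ (light v∈e) (ℕ.+-mono-≤ (light p∈) (light q∈)))

  spokeOf : ∀ (e : Edge) {v} → v ∈ᵉ e → ∀ (f : Edge) → v ∈ᵉ f → proj₁ f ≢ proj₁ e → Link.Spoke G free e v
  spokeOf e {v} v∈e f v∈f f≢e = record { edge = f ; hub∈ = v∈f ; only = only }
    where
    only : ∀ {u} → u ∈ᵉ e → u ∈ᵉ f → u ≡ v
    only {u} u∈e u∈f with u Fin.≟ v
    ... | yes u≡v = u≡v
    ... | no u≢v  = contradiction (coincide-≡ (proj₂ f) (proj₂ e) u≢v u∈f v∈f u∈e v∈e) f≢e

  -- In the link argument `v` plays `a`; of the other vertices of `e`, one of degree at least 5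
  -- plays `b` and the remaining one plays `c`.
  besideHeavy : ∀ (e : Edge) {v} → v ∈ᵉ e → degree G v ≡ 5 → Heavy (codeSum (proj₁ e)) →
    ∀ (f : Edge) → v ∈ᵉ f → proj₁ f ≢ proj₁ e → ∀ {u} → u ∈ᵉ f → u ≢ v → degree G u ≤ 3
  besideHeavy e {v} v∈e d≡5 heavy f v∈f f≢e u∈f u≢v
    with heavyPair (subst Heavy (trans (total (code ∘ degree G))
           (cong (λ d → code d + (code (degree G p) + code (degree G q))) d≡5)) heavy)
    where open Others (others e v∈e)
  ... | inj₁ (5≤dp , 4≤dq) =
    Link.Hubs.neighbours≤3 G free e v≢p v≢q p≢q v∈e p∈ q∈
      (ℕ.≤-reflexive (sym d≡5)) 5≤dp 4≤dq (spokeOf e v∈e f v∈f f≢e) u∈f u≢v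
    where open Others (others e v∈e)
  ... | inj₂ (5≤dq , 4≤dp) =
    Link.Hubs.neighbours≤3 G free e v≢q v≢p (≢-sym p≢q) v∈e q∈ p∈
      (ℕ.≤-reflexive (sym d≡5)) 5≤dq 4≤dp (spokeOf e v∈e f v∈f f≢e) u∈f u≢v
    where open Others (others e v∈e)

  given₅≤20 : ∀ v → degree G v ≡ 5 → given 5 v ≤ 20
  given₅≤20 v d≡5 with Any.any? (λ e → 5 ℕ.≤? codeSum e ×-dec codeSum e ℕ.≤? 6) (edgesAt v)
  ... | no noHeavy = subst (λ d → given 5 v ≤ d *ℕ 4) d≡5
    (given≤length* 5 v 4 (λ e∈ → share₅≤4 (λ heavy → noHeavy (lose e∈ heavy))))
  ... | yes someHeavy with find someHeavy
  -- A heavy edge takes at most 8 and the four others at most 3 each; the bound appears as 3 + 20 =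
  -- 8 + 5 · 3.
  ... | e , e∈ , heavy = ℕ.+-cancelˡ-≤ 3 _ 20
    (subst (λ d → 3 + given 5 v ≤ 8 + d *ℕ 3) d≡5
      (sum-map-exceptOne (share 5 ∘ codeSum) 8 3 (edgesAt-unique v) e∈ (share₅≤8 _) light))
    where
    light : ∀ {f} → f ∈ᴸ edgesAt v → f ≢ e → share₅ (codeSum f) ≤ 3
    light {f} f∈ f≢e = ℕ.≤-reflexive (cong share₅ (trans (total (code ∘ degree G))
      (cong₂ _+_ (cong code d≡5) (cong₂ _+_ (code≡0 (≤3 p∈ (≢-sym v≢p))) (code≡0 (≤3 q∈ (≢-sym v≢q)))))))
      where
      f∈E = proj₁ (∈-filter⁻ (v ∈?_) {xs = edges G} f∈)
      v∈f = proj₂ (∈-filter⁻ (v ∈?_) {xs = edges G} f∈)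
      e∈E = proj₁ (∈-filter⁻ (v ∈?_) {xs = edges G} e∈)
      v∈e = proj₂ (∈-filter⁻ (v ∈?_) {xs = edges G} e∈)
      open Others (others (f , f∈E) v∈f)
      ≤3 : ∀ {u} → u ∈ f → u ≢ v → degree G u ≤ 3
      ≤3 = besideHeavy (e , e∈E) v∈e d≡5 heavy (f , f∈E) v∈f f≢e

  given≤20 : ∀ v d → degree G v ≡ d → given d v ≤ 20
  given≤20 v 0 d≡ = ℕ.≤-trans (subst (λ d → given 0 v ≤ d *ℕ 20) d≡ (given≤length* 0 v 20 (λ _ → ℕ.≤-refl))) z≤n
  given≤20 v 1 d≡ = subst (λ d → given 1 v ≤ d *ℕ 20) d≡ (given≤length* 1 v 20 (λ _ → ℕ.≤-refl))
  given≤20 v 2 d≡ = subst (λ d → given 2 v ≤ d *ℕ 10) d≡ (given≤length* 2 v 10 (λ _ → ℕ.≤-refl))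
  given≤20 v 3 d≡ = given₃≤20 v d≡
  given≤20 v 4 d≡ = subst (λ d → given 4 v ≤ d *ℕ 5) d≡ (given≤length* 4 v 5 (λ _ → ℕ.≤-refl))
  given≤20 v 5 d≡ = given₅≤20 v d≡
  given≤20 v d@(suc (suc (suc (suc (suc (suc _)))))) d≡ = ℕ.≤-trans (given≤length* d v 0 (λ _ → ℕ.≤-refl))
    (ℕ.≤-trans (ℕ.≤-reflexive (ℕ.*-zeroʳ (degree G v))) z≤n)

  given≡0 : ∀ {v} → 6 ≤ degree G v → given (degree G v) v ≡ 0
  given≡0 {v} 6≤d = ℕ.n≤0⇒n≡0 (ℕ.≤-trans (given≤length* (degree G v) v 0 (λ _ → share≤0 6≤d))
    (ℕ.≤-reflexive (ℕ.*-zeroʳ (degree G v))))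
    where
    share≤0 : ∀ {d t} → 6 ≤ d → share d t ≤ 0
    share≤0 (s≤s (s≤s (s≤s (s≤s (s≤s (s≤s _)))))) = z≤n

  received≥14 : ∀ {e} → e ∈ᴸ edges G → 14 ≤ sum (map (λ v → share (degree G v) (codeSum e)) (elements e))
  received≥14 {e} e∈ with elements-triple (e , e∈)
  ... | x , _ , _ , eq = bound (received-≥14 (degree G x) (degree G p) (degree G q))
    where
    x∈ : x ∈ e
    x∈ = ∈-elements⁻ (subst (λ L → x ∈ᴸ L) (sym eq) (here refl))
    open Others (others (e , e∈) x∈)
    crowned : ∀ {u v w} → u ≢ v → u ≢ w → v ≢ w → u ∈ e → v ∈ e → w ∈ e →
      Exceeds (degree G u) (degree G v) (degree G w) → ⊥
    crowned u≢v u≢w v≢w u∈ v∈ w∈ (6≤ , 4≤ , 2≤) = free (crown-642 (e , e∈) u≢v u≢w v≢w u∈ v∈ w∈ 6≤ 4≤ 2≤)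
    bound : 14 ≤ received (degree G x) (degree G p) (degree G q) ⊎
      ExceedsSomeOrder (degree G x) (degree G p) (degree G q) →
      14 ≤ sum (map (λ v → share (degree G v) (codeSum e)) (elements e))
    bound (inj₁ 14≤) = subst (14 ≤_)
      (sym (trans (total (λ v → share (degree G v) (codeSum e)))
        (cong (λ t → share (degree G x) t + (share (degree G p) t + share (degree G q) t)) (total (code ∘ degree G))))) 14≤
    bound (inj₂ (inj₁ xpq))                             = ⊥-elim (crowned v≢p v≢q p≢q x∈ p∈ q∈ xpq)
    bound (inj₂ (inj₂ (inj₁ xqp)))                      = ⊥-elim (crowned v≢q v≢p (≢-sym p≢q) x∈ q∈ p∈ xqp)
    bound (inj₂ (inj₂ (inj₂ (inj₁ pxq))))               = ⊥-elim (crowned (≢-sym v≢p) p≢q v≢q p∈ x∈ q∈ pxq)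
    bound (inj₂ (inj₂ (inj₂ (inj₂ (inj₁ pqx)))))        = ⊥-elim (crowned p≢q (≢-sym v≢p) (≢-sym v≢q) p∈ q∈ x∈ pqx)
    bound (inj₂ (inj₂ (inj₂ (inj₂ (inj₂ (inj₁ qxp)))))) = ⊥-elim (crowned (≢-sym v≢q) (≢-sym p≢q) v≢p q∈ x∈ p∈ qxp)
    bound (inj₂ (inj₂ (inj₂ (inj₂ (inj₂ (inj₂ qpx)))))) = ⊥-elim (crowned (≢-sym p≢q) (≢-sym v≢q) (≢-sym v≢p) q∈ p∈ x∈ qpx)

  14|E|+20s≤20n : edgeCount G *ℕ 14 + countDegreeAtLeast 6 G *ℕ 20 ≤ n *ℕ 20
  14|E|+20s≤20n = begin
    edgeCount G *ℕ 14 + s20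
      ≤⟨ ℕ.+-monoˡ-≤ s20 (sum-map-≥ _ 14 (edges G) received≥14) ⟩
    sum (map (λ e → sum (map (λ v → share (degree G v) (codeSum e)) (elements e))) (edges G)) + s20
      -- By definition the row of `v` is what `v` gives, and the column of `e` is what `e` receives.
      ≡⟨ cong (λ m → m + s20) (sum-row≡sum-column _∈?_ (λ v e → share (degree G v) (codeSum e)) (allFin n) (edges G)) ⟨
    sum (map (λ v → given (degree G v) v) (allFin n)) + s20
      ≤⟨ sum-map-filter (λ v → 6 ℕ.≤? degree G v) (λ v → given (degree G v) v) 20 (allFin n)
           (λ v → given≤20 v (degree G v) refl) given≡0 ⟩
    length (allFin n) *ℕ 20
      ≡⟨ cong (λ m → m *ℕ 20) (List.length-tabulate {n = n} id) ⟩
    n *ℕ 20 ∎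
    where
    open ℕ.≤-Reasoning
    s20 = countDegreeAtLeast 6 G *ℕ 20

  7|E|≤10[n∸s] : edgeCount G *ℕ 7 ≤ 10 *ℕ (n ∸ countDegreeAtLeast 6 G)
  7|E|≤10[n∸s] = subst (edgeCount G *ℕ 7 ≤_)
    (trans (cong₂ _∸_ (ℕ.*-comm n 10) (ℕ.*-comm s 10)) (sym (ℕ.*-distribˡ-∸ 10 n s)))
    (ℕ.m+n≤o⇒m≤o∸n _ (ℕ.*-cancelʳ-≤ _ _ 2 (subst₂ _≤_
      (solve 2 (λ m k → m :* con 14 :+ k :* con 20 := (m :* con 7 :+ k :* con 10) :* con 2) refl (edgeCount G) s)
      (solve 1 (λ m → m :* con 20 := m :* con 10 :* con 2) refl n)
      14|E|+20s≤20n)))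
    where
    s = countDegreeAtLeast 6 G

theorem1p2 : (n : ℕ) (G : Linear3Graph n) → CrownFree G →
    let s = countDegreeAtLeast 6 G in
    s ≤ 2 → (+ edgeCount G) / 1 ≤ℚ (+ 10 * (+ n - + s)) / 7
-- As unnormalised fractions the two sides compare by cross-multiplication, which is the integer
-- form of the bound on `7 |E|`.
theorem1p2 n G free s≤2 = ℚ.toℚᵘ-cancel-≤
  (ℚᵘ.≤-respʳ-≃ (ℚᵘ.≃-sym (ℚ.toℚᵘ-fromℚᵘ (mkℚᵘ (+ 10 * (+ n - + s)) 6)))
    (ℚᵘ.≤-respˡ-≃ (ℚᵘ.≃-sym (ℚ.toℚᵘ-fromℚᵘ (mkℚᵘ (+ edgeCount G) 0)))
      (*≤* (subst₂ _≤ℤ_ (ℤ.pos-* (edgeCount G) 7) rhs (+≤+ (Discharging.7|E|≤10[n∸s] G free s≤2))))))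
  where
  s = countDegreeAtLeast 6 G
  -- Needed for the truncated difference `n ∸ s` to agree with the integer difference.
  s≤n : s ≤ n
  s≤n = subst (s ≤_) (List.length-tabulate {n = n} id) (List.length-filter (λ v → 6 ℕ.≤? degree G v) (allFin n))
  rhs : + (10 *ℕ (n ∸ s)) ≡ + 10 * (+ n - + s) * + 1
  rhs = begin
    + (10 *ℕ (n ∸ s))       ≡⟨ ℤ.pos-* 10 (n ∸ s) ⟩
    + 10 * + (n ∸ s)        ≡⟨ cong (λ k → + 10 * k) (trans (ℤ.m-n≡m⊖n n s) (ℤ.⊖-≥ s≤n)) ⟨
    + 10 * (+ n - + s)      ≡⟨ ℤ.*-identityʳ _ ⟨
    + 10 * (+ n - + s) * + 1 ∎
    where open ≡-Reasoning
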